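{- Fix $a\in(0,1/2]$ and an integer $m\ge2$. Then \[ \lim_{n\to\infty}\overline{\Phi}_m(n;a)=\begin{cases}0, & m \text{ even},\\ \frac{1}{2a}-1, & m\text{ odd}.\end{cases} \]
   Context: For integers $n\ge1$, $k\in[0:n]$ and real $x$, the Krawtchouk polynomial is $K_k(x)=K_k^{(n)}(x):=\sum_{j=0}^{k}(-1)^{j}\binom{x}{j}\binom{n-x}{k-j}$, with generalized binomial coefficients. Here $[m:n]=\{m,\dots,n\}$. For $n\ge m$ and real $a\in(0,1/2]$, $\overline{\Phi}_m(n;a)$ is the optimal value of the linear program: maximize $-\sum_{k=1}^{n}\left[K_k(0)+\left(\frac1a-1\right)K_k(m)\right]x_k$ over $(x_1,\dots,x_n)\in\mathbb{R}^n$ subject to $x_k\ge0$ for $k\in[1:n]$ and $\sum_{k=1}^{n}[K_k(m)-K_k(i)]x_k\ge-1$ for all $i\in[1:m-1]\cup[m+1:n]$. -}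

module Defs where

open import Algebra.Bundles using (RawRing)
import Algebra.Definitions.RawSemiring as RawSemiringDefs
open import Data.Empty using (⊥-elim)
open import Data.Fin.Base using (Fin; toℕ)
open import Data.Integer.Base using (+_)
open import Data.Nat.Base as ℕ using (ℕ; zero; suc; _∸_)
import Data.Nat.Properties as ℕ
open import Data.Product.Base using (Σ; ∃; ∃-syntax; _×_; _,_)
open import Data.Rational.Base as ℚ using (ℚ; 0ℚ; 1ℚ; ½)
import Data.Rational.Properties as ℚ
open import Data.Rational.Solver using (module +-*-Solver)
open import Data.Sum.Base using (_⊎_; inj₁; inj₂)
open import Level using (0ℓ)
open import Relation.Binary.PropositionalEquality
open import Relation.Nullary using (yes; no)

-- A real is a Cauchy sequence of rationals with its modulus, up to _≈_.
-- Strict inequality carries a positive rational gap.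

Cauchy : (ℕ → ℚ) → Set
Cauchy s = ∀ ε → 0ℚ ℚ.< ε →
  ∃[ N ] ∀ i j → N ℕ.≤ i → N ℕ.≤ j → ℚ.∣ s i ℚ.- s j ∣ ℚ.< ε

record ℝ : Set where
  no-eta-equality
  constructor mkℝ
  field
    seq    : ℕ → ℚ
    cauchy : Cauchy seq

open ℝ public

infix 4 _≈_ _≤_ _<_

record _≈_ (x y : ℝ) : Set where
  constructor mk≈
  field
    ≈-bound : ∀ ε → 0ℚ ℚ.< ε →
      ∃[ N ] ∀ n → N ℕ.≤ n → ℚ.∣ seq x n ℚ.- seq y n ∣ ℚ.≤ ε

record _≤_ (x y : ℝ) : Set where
  constructor mk≤
  field
    ≤-bound : ∀ ε → 0ℚ ℚ.< ε →
      ∃[ N ] ∀ n → N ℕ.≤ n → seq x n ℚ.≤ seq y n ℚ.+ ε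

record _<_ (x y : ℝ) : Set where
  constructor mk<
  field
    gap     : ℚ
    gap-pos : 0ℚ ℚ.< gap
    <-bound : ∃[ N ] ∀ n → N ℕ.≤ n → seq x n ℚ.+ gap ℚ.≤ seq y n

open _≈_ public
open _≤_ public
open _<_ public

half-pos : ∀ {ε} → 0ℚ ℚ.< ε → 0ℚ ℚ.< ½ ℚ.* ε
half-pos {ε} p = ℚ.positive⁻¹ (½ ℚ.* ε) {{ℚ.pos*pos⇒pos ½ ε {{ℚ.positive p}}}}

halves : ∀ ε → ½ ℚ.* ε ℚ.+ ½ ℚ.* ε ≡ ε
halves ε = trans (sym (ℚ.*-distribʳ-+ ε ½ ½)) (ℚ.*-identityˡ ε)

*-pos : ∀ {p q} → 0ℚ ℚ.< p → 0ℚ ℚ.< q → 0ℚ ℚ.< p ℚ.* q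
*-pos {p} {q} h k =
  ℚ.positive⁻¹ (p ℚ.* q) {{ℚ.pos*pos⇒pos p {{ℚ.positive h}} q {{ℚ.positive k}}}}

*-mono-≤ : ∀ {p q r s} → 0ℚ ℚ.≤ r → 0ℚ ℚ.≤ q → p ℚ.≤ q → r ℚ.≤ s →
           p ℚ.* r ℚ.≤ q ℚ.* s
*-mono-≤ {p} {q} {r} {s} 0≤r 0≤q p≤q r≤s = ℚ.≤-trans
  (ℚ.*-monoʳ-≤-nonNeg r {{ℚ.nonNegative 0≤r}} p≤q)
  (ℚ.*-monoˡ-≤-nonNeg q {{ℚ.nonNegative 0≤q}} r≤s)

abstract
  +-cauchy : ∀ {s t} → Cauchy s → Cauchy t → Cauchy (λ n → s n ℚ.+ t n)
  +-cauchy {s} {t} cs ct ε 0<ε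
    with cs (½ ℚ.* ε) (half-pos 0<ε) | ct (½ ℚ.* ε) (half-pos 0<ε)
  ... | M , hM | N , hN = M ℕ.⊔ N , λ i j hi hj → begin-strict
    ℚ.∣ (s i ℚ.+ t i) ℚ.- (s j ℚ.+ t j) ∣
      ≡⟨ cong ℚ.∣_∣ (solve 4 (λ a b c d → (a :+ b) :- (c :+ d) := (a :- c) :+ (b :- d))
           refl (s i) (t i) (s j) (t j)) ⟩
    ℚ.∣ (s i ℚ.- s j) ℚ.+ (t i ℚ.- t j) ∣
      ≤⟨ ℚ.∣p+q∣≤∣p∣+∣q∣ (s i ℚ.- s j) (t i ℚ.- t j) ⟩
    ℚ.∣ s i ℚ.- s j ∣ ℚ.+ ℚ.∣ t i ℚ.- t j ∣
      <⟨ ℚ.+-mono-< (hM i j (ℕ.m⊔n≤o⇒m≤o M N hi) (ℕ.m⊔n≤o⇒m≤o M N hj))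
                    (hN i j (ℕ.m⊔n≤o⇒n≤o M N hi) (ℕ.m⊔n≤o⇒n≤o M N hj)) ⟩
    ½ ℚ.* ε ℚ.+ ½ ℚ.* ε
      ≡⟨ halves ε ⟩
    ε ∎
    where open ℚ.≤-Reasoning
          open +-*-Solver

  neg-cauchy : ∀ {s} → Cauchy s → Cauchy (λ n → ℚ.- s n)
  neg-cauchy {s} cs ε 0<ε with cs ε 0<ε
  ... | N , h = N , λ i j hi hj → subst (ℚ._< ε) (sym (lemma i j)) (h i j hi hj)
    where
    open +-*-Solver
    lemma : ∀ i j → ℚ.∣ ℚ.- s i ℚ.- ℚ.- s j ∣ ≡ ℚ.∣ s i ℚ.- s j ∣
    lemma i j = trans
      (cong ℚ.∣_∣ (solve 2 (λ a b → (:- a) :- (:- b) := :- (a :- b)) refl (s i) (s j)))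
      (ℚ.∣-p∣≡∣p∣ (s i ℚ.- s j))

  ∣∣-lipschitz : ∀ p q → ℚ.∣ ℚ.∣ p ∣ ℚ.- ℚ.∣ q ∣ ∣ ℚ.≤ ℚ.∣ p ℚ.- q ∣
  ∣∣-lipschitz p q with ℚ.∣p∣≡p∨∣p∣≡-p (ℚ.∣ p ∣ ℚ.- ℚ.∣ q ∣)
  ... | inj₁ eq = subst (ℚ._≤ ℚ.∣ p ℚ.- q ∣) (sym eq) (below p q)
    where
    open +-*-Solver
    open ℚ.≤-Reasoning
    below : ∀ p q → ℚ.∣ p ∣ ℚ.- ℚ.∣ q ∣ ℚ.≤ ℚ.∣ p ℚ.- q ∣
    below p q = begin
      ℚ.∣ p ∣ ℚ.- ℚ.∣ q ∣
        ≡⟨ cong (λ r → ℚ.∣ r ∣ ℚ.- ℚ.∣ q ∣)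
             (solve 2 (λ a b → a := (a :- b) :+ b) refl p q) ⟩
      ℚ.∣ (p ℚ.- q) ℚ.+ q ∣ ℚ.- ℚ.∣ q ∣
        ≤⟨ ℚ.+-monoˡ-≤ (ℚ.- ℚ.∣ q ∣) (ℚ.∣p+q∣≤∣p∣+∣q∣ (p ℚ.- q) q) ⟩
      ℚ.∣ p ℚ.- q ∣ ℚ.+ ℚ.∣ q ∣ ℚ.- ℚ.∣ q ∣
        ≡⟨ solve 2 (λ a b → a :+ b :- b := a) refl ℚ.∣ p ℚ.- q ∣ ℚ.∣ q ∣ ⟩
      ℚ.∣ p ℚ.- q ∣ ∎
  ... | inj₂ eq = subst (ℚ._≤ ℚ.∣ p ℚ.- q ∣) (sym eq) (begin
      ℚ.- (ℚ.∣ p ∣ ℚ.- ℚ.∣ q ∣)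
        ≡⟨ cong (λ r → ℚ.- (ℚ.∣ p ∣ ℚ.- ℚ.∣ r ∣))
             (solve 2 (λ a b → b := (:- (a :- b)) :+ a) refl p q) ⟩
      ℚ.- (ℚ.∣ p ∣ ℚ.- ℚ.∣ ℚ.- (p ℚ.- q) ℚ.+ p ∣)
        ≡⟨ solve 2 (λ a b → :- (a :- b) := b :- a) refl
             ℚ.∣ p ∣ ℚ.∣ ℚ.- (p ℚ.- q) ℚ.+ p ∣ ⟩
      ℚ.∣ ℚ.- (p ℚ.- q) ℚ.+ p ∣ ℚ.- ℚ.∣ p ∣
        ≤⟨ ℚ.+-monoˡ-≤ (ℚ.- ℚ.∣ p ∣) (ℚ.∣p+q∣≤∣p∣+∣q∣ (ℚ.- (p ℚ.- q)) p) ⟩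
      ℚ.∣ ℚ.- (p ℚ.- q) ∣ ℚ.+ ℚ.∣ p ∣ ℚ.- ℚ.∣ p ∣
        ≡⟨ solve 2 (λ a b → a :+ b :- b := a) refl ℚ.∣ ℚ.- (p ℚ.- q) ∣ ℚ.∣ p ∣ ⟩
      ℚ.∣ ℚ.- (p ℚ.- q) ∣
        ≡⟨ ℚ.∣-p∣≡∣p∣ (p ℚ.- q) ⟩
      ℚ.∣ p ℚ.- q ∣ ∎)
    where
    open +-*-Solver
    open ℚ.≤-Reasoning

  ∣∣-cauchy : ∀ {s} → Cauchy s → Cauchy (λ n → ℚ.∣ s n ∣)
  ∣∣-cauchy {s} cs ε 0<ε with cs ε 0<ε
  ... | N , h = N , λ i j hi hj →
    ℚ.≤-<-trans (∣∣-lipschitz (s i) (s j)) (h i j hi hj)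

  bounded : ∀ {s} → Cauchy s →
            ∃[ B ] 0ℚ ℚ.< B × ∃[ N ] ∀ n → N ℕ.≤ n → ℚ.∣ s n ∣ ℚ.≤ B
  bounded {s} cs with cs 1ℚ (ℚ.positive⁻¹ 1ℚ)
  ... | N , h = 1ℚ ℚ.+ ℚ.∣ s N ∣ ,
    ℚ.+-mono-<-≤ (ℚ.positive⁻¹ 1ℚ) (ℚ.0≤∣p∣ (s N)) , N , λ n hn → begin
      ℚ.∣ s n ∣
        ≡⟨ cong ℚ.∣_∣ (solve 2 (λ a b → a := (a :- b) :+ b) refl (s n) (s N)) ⟩
      ℚ.∣ (s n ℚ.- s N) ℚ.+ s N ∣
        ≤⟨ ℚ.∣p+q∣≤∣p∣+∣q∣ (s n ℚ.- s N) (s N) ⟩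
      ℚ.∣ s n ℚ.- s N ∣ ℚ.+ ℚ.∣ s N ∣
        ≤⟨ ℚ.+-monoˡ-≤ ℚ.∣ s N ∣ (ℚ.<⇒≤ (h n N hn ℕ.≤-refl)) ⟩
      1ℚ ℚ.+ ℚ.∣ s N ∣ ∎
    where open ℚ.≤-Reasoning
          open +-*-Solver

  shrink : ∀ B → 0ℚ ℚ.< B → ∀ ε → 0ℚ ℚ.< ε → ∃[ η ] 0ℚ ℚ.< η × B ℚ.* η ≡ ε
  shrink B 0<B ε 0<ε =
    1/B ℚ.* ε ,
    *-pos (ℚ.positive⁻¹ 1/B {{ℚ.1/pos⇒pos B {{ℚ.positive 0<B}}}}) 0<ε ,
    trans (sym (ℚ.*-assoc B 1/B ε))
      (trans (cong (ℚ._* ε) (ℚ.*-inverseʳ B {{nz}})) (ℚ.*-identityˡ ε))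
    where
    nz : ℚ.NonZero B
    nz = ℚ.>-nonZero 0<B
    1/B : ℚ
    1/B = ℚ.1/_ B {{nz}}

  *-diff : ∀ a b c d → a ℚ.* b ℚ.- c ℚ.* d ≡ a ℚ.* (b ℚ.- d) ℚ.+ d ℚ.* (a ℚ.- c)
  *-diff = solve 4 (λ a b c d → a :* b :- c :* d := a :* (b :- d) :+ d :* (a :- c)) refl
    where open +-*-Solver

  *-inv-diff : ∀ u v p q → u ℚ.* v ℚ.* (p ℚ.- q) ≡ v ℚ.* (u ℚ.* p) ℚ.- u ℚ.* (v ℚ.* q)
  *-inv-diff = solve 4 (λ a b c d → a :* b :* (c :- d) := b :* (a :* c) :- a :* (b :* d)) refl
    where open +-*-Solver

  double : ∀ p → p ℚ.+ p ≡ (+ 2 ℚ./ 1) ℚ.* p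
  double p = trans (sym (cong₂ ℚ._+_ (ℚ.*-identityˡ p) (ℚ.*-identityˡ p)))
    (sym (ℚ.*-distribʳ-+ p 1ℚ 1ℚ))

  *-close : ∀ {a b c d B C η θ} → 0ℚ ℚ.< B → 0ℚ ℚ.< C →
    ℚ.∣ a ∣ ℚ.≤ B → ℚ.∣ d ∣ ℚ.≤ C → ℚ.∣ a ℚ.- c ∣ ℚ.< η → ℚ.∣ b ℚ.- d ∣ ℚ.< θ →
    ℚ.∣ a ℚ.* b ℚ.- c ℚ.* d ∣ ℚ.< B ℚ.* θ ℚ.+ C ℚ.* η
  *-close {a} {b} {c} {d} {B} {C} {η} {θ} 0<B 0<C a≤B d≤C ac bd = begin-strict
    ℚ.∣ a ℚ.* b ℚ.- c ℚ.* d ∣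
      ≡⟨ cong ℚ.∣_∣ (*-diff a b c d) ⟩
    ℚ.∣ a ℚ.* (b ℚ.- d) ℚ.+ d ℚ.* (a ℚ.- c) ∣
      ≤⟨ ℚ.∣p+q∣≤∣p∣+∣q∣ (a ℚ.* (b ℚ.- d)) (d ℚ.* (a ℚ.- c)) ⟩
    ℚ.∣ a ℚ.* (b ℚ.- d) ∣ ℚ.+ ℚ.∣ d ℚ.* (a ℚ.- c) ∣
      ≡⟨ cong₂ ℚ._+_ (ℚ.∣p*q∣≡∣p∣*∣q∣ a (b ℚ.- d)) (ℚ.∣p*q∣≡∣p∣*∣q∣ d (a ℚ.- c)) ⟩
    ℚ.∣ a ∣ ℚ.* ℚ.∣ b ℚ.- d ∣ ℚ.+ ℚ.∣ d ∣ ℚ.* ℚ.∣ a ℚ.- c ∣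
      ≤⟨ ℚ.+-mono-≤
           (ℚ.*-monoʳ-≤-nonNeg ℚ.∣ b ℚ.- d ∣ {{ℚ.∣-∣-nonNeg (b ℚ.- d)}} a≤B)
           (ℚ.*-monoʳ-≤-nonNeg ℚ.∣ a ℚ.- c ∣ {{ℚ.∣-∣-nonNeg (a ℚ.- c)}} d≤C) ⟩
    B ℚ.* ℚ.∣ b ℚ.- d ∣ ℚ.+ C ℚ.* ℚ.∣ a ℚ.- c ∣
      <⟨ ℚ.+-mono-< (ℚ.*-monoʳ-<-pos B {{ℚ.positive 0<B}} bd)
                    (ℚ.*-monoʳ-<-pos C {{ℚ.positive 0<C}} ac) ⟩
    B ℚ.* θ ℚ.+ C ℚ.* η ∎
    where open ℚ.≤-Reasoning

  *-cauchy : ∀ {s t} → Cauchy s → Cauchy t → Cauchy (λ n → s n ℚ.* t n)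
  *-cauchy {s} {t} cs ct ε 0<ε =
    let B , 0<B , L , hB = bounded cs
        C , 0<C , M , hC = bounded ct
        η , 0<η , Cη = shrink C 0<C (½ ℚ.* ε) (half-pos 0<ε)
        θ , 0<θ , Bθ = shrink B 0<B (½ ℚ.* ε) (half-pos 0<ε)
        P , hP = cs η 0<η
        Q , hQ = ct θ 0<θ
    in (L ℕ.⊔ M) ℕ.⊔ (P ℕ.⊔ Q) , λ i j hi hj →
      let LM≤i = ℕ.m⊔n≤o⇒m≤o (L ℕ.⊔ M) (P ℕ.⊔ Q) hi
          PQ≤i = ℕ.m⊔n≤o⇒n≤o (L ℕ.⊔ M) (P ℕ.⊔ Q) hi
          LM≤j = ℕ.m⊔n≤o⇒m≤o (L ℕ.⊔ M) (P ℕ.⊔ Q) hj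
          PQ≤j = ℕ.m⊔n≤o⇒n≤o (L ℕ.⊔ M) (P ℕ.⊔ Q) hj
      in subst (ℚ.∣ s i ℚ.* t i ℚ.- s j ℚ.* t j ∣ ℚ.<_)
           (trans (cong₂ ℚ._+_ Bθ Cη) (halves ε))
           (*-close {s i} {t i} {s j} {t j} {B} {C} {η} {θ} 0<B 0<C
             (hB i (ℕ.m⊔n≤o⇒m≤o L M LM≤i)) (hC j (ℕ.m⊔n≤o⇒n≤o L M LM≤j))
             (hP i j (ℕ.m⊔n≤o⇒m≤o P Q PQ≤i) (ℕ.m⊔n≤o⇒m≤o P Q PQ≤j))
             (hQ i j (ℕ.m⊔n≤o⇒n≤o P Q PQ≤i) (ℕ.m⊔n≤o⇒n≤o P Q PQ≤j)))

invℚ : ℚ → ℚ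
invℚ q with q ℚ.≟ 0ℚ
... | yes _   = 0ℚ
... | no  q≢0 = ℚ.1/_ q {{ℚ.≢-nonZero q≢0}}

invℚ-inverseʳ : ∀ q → 0ℚ ℚ.< q → q ℚ.* invℚ q ≡ 1ℚ
invℚ-inverseʳ q 0<q with q ℚ.≟ 0ℚ
... | yes q≡0 = ⊥-elim (ℚ.<⇒≢ 0<q (sym q≡0))
... | no  q≢0 = ℚ.*-inverseʳ q {{ℚ.≢-nonZero q≢0}}

abstract
  inv-cauchy : ∀ {s} → Cauchy s → ∀ δ → 0ℚ ℚ.< δ →
               (∃[ N ] ∀ n → N ℕ.≤ n → δ ℚ.≤ s n) → Cauchy (λ n → invℚ (s n))
  inv-cauchy {s} cs δ 0<δ (M , hM) ε 0<ε
    with cs (δ ℚ.* δ ℚ.* ε) (*-pos (*-pos 0<δ 0<δ) 0<ε)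
  ... | N , hN = M ℕ.⊔ N , λ i j hi hj →
    close (s i) (s j) (hM i (ℕ.m⊔n≤o⇒m≤o M N hi)) (hM j (ℕ.m⊔n≤o⇒m≤o M N hj))
      (hN j i (ℕ.m⊔n≤o⇒n≤o M N hj) (ℕ.m⊔n≤o⇒n≤o M N hi))
    where
    open ℚ.≤-Reasoning
    open +-*-Solver
    close : ∀ u v → δ ℚ.≤ u → δ ℚ.≤ v → ℚ.∣ v ℚ.- u ∣ ℚ.< δ ℚ.* δ ℚ.* ε →
            ℚ.∣ invℚ u ℚ.- invℚ v ∣ ℚ.< ε
    close u v δ≤u δ≤v h =
      ℚ.*-cancelˡ-<-nonNeg (u ℚ.* v) {{ℚ.nonNegative (ℚ.<⇒≤ 0<uv)}} (begin-strict
        u ℚ.* v ℚ.* ℚ.∣ invℚ u ℚ.- invℚ v ∣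
          ≡⟨ cong (ℚ._* ℚ.∣ invℚ u ℚ.- invℚ v ∣)
               (sym (ℚ.0≤p⇒∣p∣≡p (ℚ.<⇒≤ 0<uv))) ⟩
        ℚ.∣ u ℚ.* v ∣ ℚ.* ℚ.∣ invℚ u ℚ.- invℚ v ∣
          ≡⟨ ℚ.∣p*q∣≡∣p∣*∣q∣ (u ℚ.* v) (invℚ u ℚ.- invℚ v) ⟨
        ℚ.∣ u ℚ.* v ℚ.* (invℚ u ℚ.- invℚ v) ∣
          ≡⟨ cong ℚ.∣_∣ (*-inv-diff u v (invℚ u) (invℚ v)) ⟩
        ℚ.∣ v ℚ.* (u ℚ.* invℚ u) ℚ.- u ℚ.* (v ℚ.* invℚ v) ∣
          ≡⟨ cong₂ (λ c d → ℚ.∣ v ℚ.* c ℚ.- u ℚ.* d ∣)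
               (invℚ-inverseʳ u 0<u) (invℚ-inverseʳ v 0<v) ⟩
        ℚ.∣ v ℚ.* 1ℚ ℚ.- u ℚ.* 1ℚ ∣
          ≡⟨ cong₂ (λ c d → ℚ.∣ c ℚ.- d ∣) (ℚ.*-identityʳ v) (ℚ.*-identityʳ u) ⟩
        ℚ.∣ v ℚ.- u ∣
          <⟨ h ⟩
        δ ℚ.* δ ℚ.* ε
          ≤⟨ ℚ.*-monoʳ-≤-nonNeg ε {{ℚ.nonNegative (ℚ.<⇒≤ 0<ε)}}
               (*-mono-≤ (ℚ.<⇒≤ 0<δ) (ℚ.<⇒≤ 0<u) δ≤u δ≤v) ⟩
        u ℚ.* v ℚ.* ε ∎)
      where
      0<u : 0ℚ ℚ.< u
      0<u = ℚ.<-≤-trans 0<δ δ≤u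
      0<v : 0ℚ ℚ.< v
      0<v = ℚ.<-≤-trans 0<δ δ≤v
      0<uv : 0ℚ ℚ.< u ℚ.* v
      0<uv = *-pos 0<u 0<v

infix  8 -_
infixl 7 _*_
infixl 6 _+_ _-_

fromℚ : ℚ → ℝ
fromℚ q .seq _          = q
fromℚ q .cauchy ε 0<ε = 0 , λ i j _ _ →
  subst (ℚ._< ε) (sym (cong ℚ.∣_∣ (ℚ.+-inverseʳ q))) 0<ε

fromℕ : ℕ → ℝ
fromℕ n = fromℚ (+ n ℚ./ 1)

0ℝ 1ℝ 2ℝ : ℝ
0ℝ = fromℕ 0
1ℝ = fromℕ 1
2ℝ = fromℕ 2

_+_ _*_ : ℝ → ℝ → ℝ
(x + y) .seq n  = seq x n ℚ.+ seq y n
(x + y) .cauchy = +-cauchy {seq x} {seq y} (cauchy x) (cauchy y)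
(x * y) .seq n  = seq x n ℚ.* seq y n
(x * y) .cauchy = *-cauchy {seq x} {seq y} (cauchy x) (cauchy y)

-_ ∣_∣ : ℝ → ℝ
(- x) .seq n  = ℚ.- seq x n
(- x) .cauchy = neg-cauchy {seq x} (cauchy x)
∣ x ∣ .seq n  = ℚ.∣ seq x n ∣
∣ x ∣ .cauchy = ∣∣-cauchy {seq x} (cauchy x)

_-_ : ℝ → ℝ → ℝ
x - y = x + (- y)

-- Terms of the sequence that vanish, of which there are finitely many,
-- are sent to zero.
1/_[_] : (x : ℝ) → 0ℝ < x → ℝ
1/ x [ 0<x ] .seq n  = invℚ (seq x n)
1/ x [ 0<x ] .cauchy with 0<x
... | mk< δ 0<δ (N , δ≤x) = inv-cauchy {seq x} (cauchy x) δ 0<δ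
  (N , λ n N≤n → subst (ℚ._≤ seq x n) (ℚ.+-identityˡ δ) (δ≤x n N≤n))

2*-pos : ∀ {x} → 0ℝ < x → 0ℝ < 2ℝ * x
2*-pos {x} (mk< δ 0<δ (N , δ≤x)) = mk< δ 0<δ (N , λ n N≤n → begin
    0ℚ ℚ.+ δ              ≤⟨ δ≤x n N≤n ⟩
    seq x n               ≡⟨ ℚ.+-identityʳ (seq x n) ⟨
    seq x n ℚ.+ 0ℚ        ≤⟨ ℚ.+-monoʳ-≤ (seq x n) (0≤x n N≤n) ⟩
    seq x n ℚ.+ seq x n   ≡⟨ double (seq x n) ⟩
    (+ 2 ℚ./ 1) ℚ.* seq x n ∎)
  where
  open ℚ.≤-Reasoning
  0≤x : ∀ n → N ℕ.≤ n → 0ℚ ℚ.≤ seq x n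
  0≤x n N≤n = ℚ.≤-trans (ℚ.<⇒≤ 0<δ)
    (subst (ℚ._≤ seq x n) (ℚ.+-identityˡ δ) (δ≤x n N≤n))

ℝ-rawRing : RawRing 0ℓ 0ℓ
ℝ-rawRing = record
  { Carrier = ℝ
  ; _≈_     = _≈_
  ; _+_     = _+_
  ; _*_     = _*_
  ; -_      = -_
  ; 0#      = 0ℝ
  ; 1#      = 1ℝ
  }

open RawSemiringDefs (RawRing.rawSemiring ℝ-rawRing) public using (_^_; sum)

binom : ℝ → ℕ → ℝ
binom x zero    = 1ℝ
binom x (suc j) = binom x j * (x - fromℕ j) * fromℚ (+ 1 ℚ./ suc j)

K : (n k : ℕ) → ℝ → ℝ
K n k x = sum {suc k} λ j →
  (- 1ℝ) ^ toℕ j * binom x (toℕ j) * binom (fromℕ n - x) (k ∸ toℕ j)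

-- The variable indexed by k ∈ [1:n] is the value of x at k - 1 : Fin n.

module LP (m n : ℕ) (a : ℝ) (0<a : 0ℝ < a) where

  objective : (Fin n → ℝ) → ℝ
  objective x = - sum {n} λ p → let k = suc (toℕ p) in
    (K n k 0ℝ + (1/ a [ 0<a ] - 1ℝ) * K n k (fromℕ m)) * x p

  Feasible : (Fin n → ℝ) → Set
  Feasible x =
    (∀ p → 0ℝ ≤ x p) ×
    (∀ i → (1 ℕ.≤ i × i ℕ.< m) ⊎ (m ℕ.< i × i ℕ.≤ n) →
      - 1ℝ ≤ sum {n} λ p → let k = suc (toℕ p) in
        (K n k (fromℕ m) - K n k (fromℕ i)) * x p)

  -- The supremum of the objective, in its constructive form: everything below
  -- v is exceeded.  Attainment is not required.
  IsOptimalValue : ℝ → Set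
  IsOptimalValue v =
    (∀ x → Feasible x → objective x ≤ v) ×
    (∀ w → w < v → ∃[ x ] Feasible x × w < objective x)

-- A sequence is given by the relation "v is the value at n", because the
-- linear program above is unbounded, with no real optimal value, when 2ⁿ < 1/a.
-- As for extended-real sequences, convergence to a real requires the value
-- to exist as a real from some n on.
_TendsTo_ : (ℕ → ℝ → Set) → ℝ → Set
P TendsTo l = ∀ ε → 0ℝ < ε → ∃[ N ] ∀ n → N ℕ.≤ n →
  (∃[ v ] P n v) × (∀ v → P n v → ∣ v - l ∣ < ε)

{-
For n large the optimal value is exactly the limit.  The coefficient of x_k in the
objective is - (C(n,k) + (1/a - 1) K_k(m)), where K_k(m) is the coefficient of z^k in
(1 - z)^m (1 + z)^(n - m).  The three-term recurrence
  (n - 2k) K_k(r) = (n - r) K_k(r + 1) + r K_k(r - 1)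
gives K_k(r + 2) = ((n - 2k)/n)² K_k(r) + O(C(n,k)/n), hence n K_k(r) ≥ - r(r - 1) C(n,k)
for r even.  So for m even all these coefficients are eventually ≤ 0, and x = 0 is optimal.

For m odd put b = 1/(2a) and r = m - 1.  The point with x_n = 1/2 and other coordinates 0
has value b - 1, and b - 1 as multiplier of the constraint i = r certifies its optimality:
by Pascal's rule the reduced cost C(n,k) + b K_k(m) + (b - 1) K_k(r) is the sum of
C(n-1,k-1) - K_{k-1}(r) ≥ 0 and C(n-1,k) + (2b - 1) K_k(r), with K now taken for n - 1;
the latter is the coefficient already shown to be ≥ 0, since r is even.
-}

module Submission where

open import Data.Empty using (⊥-elim)
open import Data.Fin.Base using (Fin; zero; suc; toℕ)
open import Data.Integer.Base as ℤ using (+_)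
import Data.Integer.Properties as ℤ
open import Data.Nat.Base as ℕ using (ℕ; zero; suc; pred; _∸_)
open import Data.Nat.Divisibility using (_∣_; _∤_; divides)
import Data.Nat.Properties as ℕ
open import Data.Product.Base using (_×_; _,_; proj₁; proj₂; ∃-syntax)
open import Data.Rational.Base as ℚ using (ℚ; 0ℚ; 1ℚ; ½; mkℚ)
import Data.Rational.Properties as ℚ
open import Data.Rational.Solver using (module +-*-Solver)
open import Data.Rational.Unnormalised.Base as ℚᵘ using (mkℚᵘ)
import Data.Rational.Unnormalised.Properties as ℚᵘ
open import Data.Sum.Base using (_⊎_; inj₁; inj₂)
open import Defs using (*-pos)
open import Function.Base using (_∘_)
open import Relation.Binary.PropositionalEquality
open +-*-Solver

module Krawtchouk where
  open import Data.Rational.Base using (_+_; _*_; _-_; -_; _≤_)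
  open ≡-Reasoning

  -- Naturals inside the rationals, and sign lemmas.

  ι : ℕ → ℚ
  ι n = + n ℚ./ 1

  ι-+ : ∀ m n → ι (m ℕ.+ n) ≡ ι m + ι n
  ι-+ m n = ℚ.toℚᵘ-injective (ℚᵘ.≃-trans (ℚ.toℚᵘ-fromℚᵘ (mkℚᵘ (+ (m ℕ.+ n)) 0))
    (ℚᵘ.≃-trans (ℚᵘ.*≡* integers)
    (ℚᵘ.≃-trans (ℚᵘ.≃-sym (ℚᵘ.+-cong (ℚ.toℚᵘ-fromℚᵘ (mkℚᵘ (+ m) 0)) (ℚ.toℚᵘ-fromℚᵘ (mkℚᵘ (+ n) 0))))
      (ℚᵘ.≃-sym (ℚ.toℚᵘ-homo-+ (ι m) (ι n))))))
    where
    integers : + (m ℕ.+ n) ℤ.* (+ 1 ℤ.* + 1) ≡ (+ m ℤ.* + 1 ℤ.+ + n ℤ.* + 1) ℤ.* + 1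
    integers = cong (ℤ._* + 1) (sym (cong₂ ℤ._+_ (ℤ.*-identityʳ (+ m)) (ℤ.*-identityʳ (+ n))))

  ι-inverse : ∀ j → (+ 1 ℚ./ suc j) * ι (suc j) ≡ 1ℚ
  ι-inverse j = ℚ.toℚᵘ-injective (ℚᵘ.≃-trans (ℚ.toℚᵘ-homo-* (+ 1 ℚ./ suc j) (ι (suc j)))
    (ℚᵘ.≃-trans (ℚᵘ.*-cong (ℚ.toℚᵘ-fromℚᵘ (mkℚᵘ (+ 1) j)) (ℚ.toℚᵘ-fromℚᵘ (mkℚᵘ (+ suc j) 0)))
      (ℚᵘ.*≡* (trans (ℤ.*-identityʳ (+ 1 ℤ.* + suc j))
        (cong (λ d → + 1 ℤ.* + d) (sym (ℕ.*-identityʳ (suc j))))))))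

  0≤ι : ∀ n → 0ℚ ≤ ι n
  0≤ι n = ℚ.nonNegative⁻¹ (ι n) {{ℚ.normalize-nonNeg n 1}}

  -- The absolute value of the numerator serves, since the denominator is at least 1.
  ι-archimedean : ∀ p → ∃[ N ] p ≤ ι N
  ι-archimedean (mkℚ i d c) = ℤ.∣ i ∣ , ℚ.toℚᵘ-cancel-≤ (ℚᵘ.≤-respʳ-≃
    (ℚᵘ.≃-sym (ℚ.toℚᵘ-fromℚᵘ (mkℚᵘ (+ ℤ.∣ i ∣) 0))) (ℚᵘ.*≤* (numerators i)))
    where
    numerators : ∀ i → i ℤ.* + 1 ℤ.≤ + ℤ.∣ i ∣ ℤ.* + suc d
    numerators (+ n)       = subst₂ ℤ._≤_ (ℤ.pos-* n 1) (ℤ.pos-* n (suc d))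
                               (ℤ.+≤+ (ℕ.*-monoʳ-≤ n (ℕ.s≤s ℕ.z≤n)))
    numerators (ℤ.-[1+ n ]) = ℤ.-≤+

  ι-suc : ∀ n → ι (suc n) ≡ 1ℚ + ι n
  ι-suc = ι-+ 1

  0<ι-suc : ∀ n → 0ℚ ℚ.< ι (suc n)
  0<ι-suc n = ℚ.positive⁻¹ (ι (suc n)) {{ℚ.normalize-pos (suc n) 1}}

  0≤-+ : ∀ {p q} → 0ℚ ≤ p → 0ℚ ≤ q → 0ℚ ≤ p + q
  0≤-+ = ℚ.+-mono-≤

  0≤-* : ∀ {p q} → 0ℚ ≤ p → 0ℚ ≤ q → 0ℚ ≤ p * q
  0≤-* {p} {q} 0≤p 0≤q = ℚ.nonNegative⁻¹ (p * q)
    {{ℚ.nonNeg*nonNeg⇒nonNeg p {{ℚ.nonNegative 0≤p}} q {{ℚ.nonNegative 0≤q}}}}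

  0≤-square : ∀ p → 0ℚ ≤ p * p
  0≤-square p = subst (0ℚ ≤_) eq (0≤-* (ℚ.0≤∣p∣ p) (ℚ.0≤∣p∣ p))
    where
    eq : ℚ.∣ p ∣ * ℚ.∣ p ∣ ≡ p * p
    eq with ℚ.∣p∣≡p∨∣p∣≡-p p
    ... | inj₁ e = cong₂ _*_ e e
    ... | inj₂ e = trans (cong₂ _*_ e e)
      (solve 1 (λ x → (:- x) :* (:- x) := x :* x) refl p)

  0≤-cancel : ∀ {c p} → 0ℚ ℚ.< c → 0ℚ ≤ c * p → 0ℚ ≤ p
  0≤-cancel {c} {p} 0<c 0≤cp = ℚ.*-cancelˡ-≤-pos c {{ℚ.positive 0<c}}
    (subst (_≤ c * p) (sym (ℚ.*-zeroʳ c)) 0≤cp)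

  ≤⇒0≤- : ∀ {p q} → p ≤ q → 0ℚ ≤ q - p
  ≤⇒0≤- {p} {q} p≤q = subst (_≤ q - p) (ℚ.+-inverseʳ p) (ℚ.+-monoˡ-≤ (- p) p≤q)

  0≤-⇒≤ : ∀ {p q} → 0ℚ ≤ q - p → p ≤ q
  0≤-⇒≤ {p} {q} 0≤q-p = subst₂ _≤_ (ℚ.+-identityˡ p)
    (solve 2 (λ x y → (y :- x) :+ x := y) refl p q) (ℚ.+-monoˡ-≤ p 0≤q-p)

  -- Coefficients of (1 - z)^m (1 + z)^l.

  -- Sequences are read as generating functions in a variable z.

  shift times1+z times1-z : (ℕ → ℚ) → ℕ → ℚ
  shift f zero    = 0ℚ
  shift f (suc k) = f k
  times1+z f k = f k + shift f k
  times1-z f k = f k - shift f k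

  -- κ m l k is the coefficient of z^k in (1 - z)^m (1 + z)^l, that is K_k(m) for n = m + l.
  κ : ℕ → ℕ → ℕ → ℚ
  κ zero    zero    zero    = 1ℚ
  κ zero    zero    (suc k) = 0ℚ
  κ zero    (suc l) k       = times1+z (κ zero l) k
  κ (suc m) l       k       = times1-z (κ m l) k

  shift-cong : ∀ {f g} → (∀ k → f k ≡ g k) → ∀ k → shift f k ≡ shift g k
  shift-cong f≗g zero    = refl
  shift-cong f≗g (suc k) = f≗g k

  shift-comb : ∀ a b (f g : ℕ → ℚ) k →
    shift (λ i → a * f i + b * g i) k ≡ a * shift f k + b * shift g k
  shift-comb a b f g zero    = solve 2 (λ a b → con 0ℚ := a :* con 0ℚ :+ b :* con 0ℚ) refl a b
  shift-comb a b f g (suc k) = refl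

  shift-times1+z : ∀ f k → shift (times1+z f) k ≡ shift f k + shift (shift f) k
  shift-times1+z f zero    = refl
  shift-times1+z f (suc k) = refl

  shift-times1-z : ∀ f k → shift (times1-z f) k ≡ shift f k - shift (shift f) k
  shift-times1-z f zero    = refl
  shift-times1-z f (suc k) = refl

  -- `κ` peels off the factors 1 - z first; a factor 1 + z is reached by commuting it past them.
  κ-sucʳ : ∀ m l k → κ m (suc l) k ≡ times1+z (κ m l) k
  κ-sucʳ zero    l k = refl
  κ-sucʳ (suc m) l k = begin
    κ m (suc l) k - shift (κ m (suc l)) k
      ≡⟨ cong₂ _-_ (κ-sucʳ m l k) (trans (shift-cong (κ-sucʳ m l) k) (shift-times1+z (κ m l) k)) ⟩
    (κ m l k + shift (κ m l) k) - (shift (κ m l) k + shift (shift (κ m l)) k)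
      ≡⟨ solve 3 (λ x y z → (x :+ y) :- (y :+ z) := (x :- y) :+ (y :- z)) refl
           (κ m l k) (shift (κ m l) k) (shift (shift (κ m l)) k) ⟩
    (κ m l k - shift (κ m l) k) + (shift (κ m l) k - shift (shift (κ m l)) k)
      ≡⟨ cong (λ x → times1-z (κ m l) k + x) (shift-times1-z (κ m l) k) ⟨
    times1+z (κ (suc m) l) k ∎

  -- Three-term recurrence in the first index.

  -- For F = (1 - z)^r (1 + z)^l and ν = r + l, the coefficients of
  -- ν F - 2 z F' are those of F weighted by ν - 2 k.
  weight : ℚ → ℕ → ℚ
  weight ν k = ν - (ι k + ι k)

  weighted : ℚ → (ℕ → ℚ) → ℕ → ℚ
  weighted ν f k = weight ν k * f k

  -- Product rule: differentiating the factor 1 + z contributes -2 z F, and raising ν by one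
  -- contributes (1 + z) F; together they make (1 - z) F. For a factor 1 - z the two signs are
  -- exchanged.
  weighted-times1+z : ∀ ν f k → weighted (1ℚ + ν) (times1+z f) k ≡
    times1+z (weighted ν f) k + times1-z f k
  weighted-times1+z ν f zero = solve 3 (λ ν c x →
    (con 1ℚ :+ ν :- (c :+ c)) :* (x :+ con 0ℚ) :=
    ((ν :- (c :+ c)) :* x :+ con 0ℚ) :+ (x :- con 0ℚ)) refl ν (ι 0) (f 0)
  weighted-times1+z ν f (suc k) rewrite ι-suc k = solve 4 (λ ν c x y →
    (con 1ℚ :+ ν :- ((con 1ℚ :+ c) :+ (con 1ℚ :+ c))) :* (x :+ y) :=
    ((ν :- ((con 1ℚ :+ c) :+ (con 1ℚ :+ c))) :* x :+ (ν :- (c :+ c)) :* y) :+ (x :- y))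
    refl ν (ι k) (f (suc k)) (f k)

  weighted-times1-z : ∀ ν f k → weighted (1ℚ + ν) (times1-z f) k ≡
    times1-z (weighted ν f) k + times1+z f k
  weighted-times1-z ν f zero = solve 3 (λ ν c x →
    (con 1ℚ :+ ν :- (c :+ c)) :* (x :- con 0ℚ) :=
    ((ν :- (c :+ c)) :* x :- con 0ℚ) :+ (x :+ con 0ℚ)) refl ν (ι 0) (f 0)
  weighted-times1-z ν f (suc k) rewrite ι-suc k = solve 4 (λ ν c x y →
    (con 1ℚ :+ ν :- ((con 1ℚ :+ c) :+ (con 1ℚ :+ c))) :* (x :- y) :=
    ((ν :- ((con 1ℚ :+ c) :+ (con 1ℚ :+ c))) :* x :- (ν :- (c :+ c)) :* y) :+ (x :+ y))
    refl ν (ι k) (f (suc k)) (f k)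

  -- Multiplying by 1 + z undoes `pred l` unless `l = 0`, where `pred` truncates; there the factor
  -- `ι l` annihilates both sides.
  κ-pred-1+z : ∀ m l k → ι l * times1+z (κ m (pred l)) k ≡ ι l * κ m l k
  κ-pred-1+z m zero    k = trans (ℚ.*-zeroˡ (times1+z (κ m 0) k)) (sym (ℚ.*-zeroˡ (κ m 0 k)))
  κ-pred-1+z m (suc l) k = cong (ι (suc l) *_) (sym (κ-sucʳ m l k))

  κ-pred-1-z : ∀ m l k → ι m * times1-z (κ (pred m) l) k ≡ ι m * κ m l k
  κ-pred-1-z zero    l k = trans (ℚ.*-zeroˡ (times1-z (κ 0 l) k)) (sym (ℚ.*-zeroˡ (κ 0 l k)))
  κ-pred-1-z (suc m) l k = refl

  -- ν F - 2 z F' = l (1 - z)^(r+1) (1 + z)^(l-1) + r (1 - z)^(r-1) (1 + z)^(l+1).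
  weighted-κ : ∀ r l k → weighted (ι (r ℕ.+ l)) (κ r l) k ≡
    ι l * κ (suc r) (pred l) k + ι r * κ (pred r) (suc l) k
  weighted-κ zero zero zero    = refl
  weighted-κ zero zero (suc k) = solve 3 (λ w x y → w :* con 0ℚ := con 0ℚ :* x :+ con 0ℚ :* y)
    refl (weight (ι 0) (suc k)) (κ 1 0 (suc k)) (κ 0 1 (suc k))
  weighted-κ zero (suc l) k    = begin
    weighted (ι (suc l)) (times1+z A) k
      ≡⟨ cong (λ ν → weighted ν (times1+z A) k) (ι-suc l) ⟩
    weighted (1ℚ + ι l) (times1+z A) k
      ≡⟨ weighted-times1+z (ι l) A k ⟩
    weighted (ι l) A k + shift (weighted (ι l) A) k + times1-z A k
      ≡⟨ cong (_+ times1-z A k) (cong₂ _+_ (weighted-κ zero l k)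
           (trans (shift-cong (weighted-κ zero l) k) (shift-comb (ι l) (ι 0) C D k))) ⟩
    (ι l * C k + ι 0 * D k) + (ι l * shift C k + ι 0 * shift D k) + times1-z A k
      ≡⟨ solve 6 (λ l c d c' d' a →
           (l :* c :+ con 0ℚ :* d) :+ (l :* c' :+ con 0ℚ :* d') :+ a :=
           l :* (c :+ c') :+ a) refl (ι l) (C k) (D k) (shift C k) (shift D k) (times1-z A k) ⟩
    ι l * times1+z C k + κ 1 l k
      ≡⟨ cong (_+ κ 1 l k) (κ-pred-1+z 1 l k) ⟩
    ι l * κ 1 l k + κ 1 l k
      ≡⟨ solve 3 (λ l a e → l :* a :+ a := (con 1ℚ :+ l) :* a :+ con 0ℚ :* e) refl
           (ι l) (κ 1 l k) (κ 0 (suc (suc l)) k) ⟩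
    (1ℚ + ι l) * κ 1 l k + ι 0 * κ 0 (suc (suc l)) k
      ≡⟨ cong (λ ν → ν * κ 1 l k + ι 0 * κ 0 (suc (suc l)) k) (ι-suc l) ⟨
    ι (suc l) * κ 1 l k + ι 0 * κ 0 (suc (suc l)) k ∎
    where
    A C D : ℕ → ℚ
    A = κ 0 l
    C = κ 1 (pred l)
    D = κ 0 (suc l)
  weighted-κ (suc r) l k = begin
    weighted (ι (suc (r ℕ.+ l))) (times1-z A) k
      ≡⟨ cong (λ ν → weighted ν (times1-z A) k) (ι-suc (r ℕ.+ l)) ⟩
    weighted (1ℚ + ι (r ℕ.+ l)) (times1-z A) k
      ≡⟨ weighted-times1-z (ι (r ℕ.+ l)) A k ⟩
    weighted (ι (r ℕ.+ l)) A k - shift (weighted (ι (r ℕ.+ l)) A) k + times1+z A k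
      ≡⟨ cong₂ _+_ (cong₂ _-_ (weighted-κ r l k)
           (trans (shift-cong (weighted-κ r l) k) (shift-comb (ι l) (ι r) C D k)))
           (sym (κ-sucʳ r l k)) ⟩
    (ι l * C k + ι r * D k) - (ι l * shift C k + ι r * shift D k) + κ r (suc l) k
      ≡⟨ solve 7 (λ l r c d c' d' a →
           (l :* c :+ r :* d) :- (l :* c' :+ r :* d') :+ a :=
           l :* (c :- c') :+ (r :* (d :- d') :+ a)) refl
           (ι l) (ι r) (C k) (D k) (shift C k) (shift D k) (κ r (suc l) k) ⟩
    ι l * κ (suc (suc r)) (pred l) k + (ι r * times1-z D k + κ r (suc l) k)
      ≡⟨ cong (λ x → ι l * κ (suc (suc r)) (pred l) k + (x + κ r (suc l) k))
           (κ-pred-1-z r (suc l) k) ⟩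
    ι l * κ (suc (suc r)) (pred l) k + (ι r * κ r (suc l) k + κ r (suc l) k)
      ≡⟨ cong (λ x → ι l * κ (suc (suc r)) (pred l) k + x)
           (solve 2 (λ r a → r :* a :+ a := (con 1ℚ :+ r) :* a) refl (ι r) (κ r (suc l) k)) ⟩
    ι l * κ (suc (suc r)) (pred l) k + (1ℚ + ι r) * κ r (suc l) k
      ≡⟨ cong (λ ν → ι l * κ (suc (suc r)) (pred l) k + ν * κ r (suc l) k) (ι-suc r) ⟨
    ι l * κ (suc (suc r)) (pred l) k + ι (suc r) * κ r (suc l) k ∎
    where
    A C D : ℕ → ℚ
    A = κ r l
    C = κ (suc r) (pred l)
    D = κ (pred r) (suc l)

  -- Bounds by binomial coefficients.

  0≤∣p∣+p : ∀ p → 0ℚ ≤ ℚ.∣ p ∣ + p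
  0≤∣p∣+p p with ℚ.∣p∣≡p∨∣p∣≡-p p
  ... | inj₁ e = subst (λ x → 0ℚ ≤ ℚ.∣ p ∣ + x) e (0≤-+ (ℚ.0≤∣p∣ p) (ℚ.0≤∣p∣ p))
  ... | inj₂ e = ℚ.≤-reflexive (sym (trans (cong (_+ p) e) (ℚ.+-inverseˡ p)))

  ∣p∣≤q⇒0≤q+p : ∀ {p q} → ℚ.∣ p ∣ ≤ q → 0ℚ ≤ q + p
  ∣p∣≤q⇒0≤q+p {p} {q} h = ℚ.≤-trans (0≤∣p∣+p p) (ℚ.+-monoˡ-≤ p h)

  ∣p∣≤q⇒0≤q-p : ∀ {p q} → ℚ.∣ p ∣ ≤ q → 0ℚ ≤ q - p
  ∣p∣≤q⇒0≤q-p {p} {q} h = ∣p∣≤q⇒0≤q+p (subst (_≤ q) (sym (ℚ.∣-p∣≡∣p∣ p)) h)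

  0≤κ₀ : ∀ l k → 0ℚ ≤ κ 0 l k
  0≤κ₀ zero    zero    = ℚ.nonNegative⁻¹ 1ℚ
  0≤κ₀ zero    (suc k) = ℚ.≤-refl
  0≤κ₀ (suc l) zero    = 0≤-+ (0≤κ₀ l zero) ℚ.≤-refl
  0≤κ₀ (suc l) (suc k) = 0≤-+ (0≤κ₀ l (suc k)) (0≤κ₀ l k)

  -- By the triangle inequality, turning a factor 1 - z into 1 + z can only enlarge the bound on
  -- each coefficient.
  ∣κ∣≤κ₀ : ∀ r l {n} k → r ℕ.+ l ≡ n → ℚ.∣ κ r l k ∣ ≤ κ 0 n k
  ∣κ∣≤κ₀ zero    l k refl = ℚ.≤-reflexive (ℚ.0≤p⇒∣p∣≡p (0≤κ₀ l k))
  ∣κ∣≤κ₀ (suc r) l k refl = ℚ.≤-trans (ℚ.∣p-q∣≤∣p∣+∣q∣ (κ r l k) (shift (κ r l) k))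
    (ℚ.+-mono-≤ (∣κ∣≤κ₀ r l k refl) (∣shift∣≤ k))
    where
    ∣shift∣≤ : ∀ k → ℚ.∣ shift (κ r l) k ∣ ≤ shift (κ 0 (r ℕ.+ l)) k
    ∣shift∣≤ zero    = ℚ.≤-refl
    ∣shift∣≤ (suc k) = ∣κ∣≤κ₀ r l k refl

  -- Where pred truncates, the factor ι l or ι r vanishes.
  ∣weighted-κ∣≤ : ∀ r l {n} k → r ℕ.+ l ≡ n →
    ℚ.∣ weighted (ι n) (κ r l) k ∣ ≤ ι n * κ 0 n k
  ∣weighted-κ∣≤ r l {n} k refl = R.begin
    ℚ.∣ weighted (ι n) (κ r l) k ∣
      R.≡⟨ cong ℚ.∣_∣ (weighted-κ r l k) ⟩
    ℚ.∣ ι l * κ (suc r) (pred l) k + ι r * κ (pred r) (suc l) k ∣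
      R.≤⟨ ℚ.∣p+q∣≤∣p∣+∣q∣ (ι l * κ (suc r) (pred l) k) (ι r * κ (pred r) (suc l) k) ⟩
    ℚ.∣ ι l * κ (suc r) (pred l) k ∣ + ℚ.∣ ι r * κ (pred r) (suc l) k ∣
      R.≤⟨ ℚ.+-mono-≤ (left l refl) (right r refl) ⟩
    ι l * κ 0 n k + ι r * κ 0 n k
      R.≡⟨ solve 3 (λ l r b → l :* b :+ r :* b := (r :+ l) :* b) refl (ι l) (ι r) (κ 0 n k) ⟩
    (ι r + ι l) * κ 0 n k
      R.≡⟨ cong (_* κ 0 n k) (ι-+ r l) ⟨
    ι n * κ 0 n k R.∎
    where
    module R = ℚ.≤-Reasoning
    scaled : ∀ c {a b} → ℚ.∣ a ∣ ≤ b → ℚ.∣ ι c * a ∣ ≤ ι c * b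
    scaled c {a} h = ℚ.≤-trans
      (ℚ.≤-reflexive (trans (ℚ.∣p*q∣≡∣p∣*∣q∣ (ι c) a) (cong (_* ℚ.∣ a ∣) (ℚ.0≤p⇒∣p∣≡p (0≤ι c)))))
      (ℚ.*-monoˡ-≤-nonNeg (ι c) {{ℚ.nonNegative (0≤ι c)}} h)
    vanish : ∀ a b → ℚ.∣ ι 0 * a ∣ ≤ ι 0 * b
    vanish a b = ℚ.≤-reflexive (trans (cong ℚ.∣_∣ (ℚ.*-zeroˡ a)) (sym (ℚ.*-zeroˡ b)))
    left : ∀ l → r ℕ.+ l ≡ n → ℚ.∣ ι l * κ (suc r) (pred l) k ∣ ≤ ι l * κ 0 n k
    left zero    _  = vanish (κ (suc r) 0 k) (κ 0 n k)
    left (suc l) eq = scaled (suc l) (∣κ∣≤κ₀ (suc r) l k (trans (sym (ℕ.+-suc r l)) eq))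
    right : ∀ r → r ℕ.+ l ≡ n → ℚ.∣ ι r * κ (pred r) (suc l) k ∣ ≤ ι r * κ 0 n k
    right zero    _  = vanish (κ 0 (suc l) k) (κ 0 n k)
    right (suc r) eq = scaled (suc r) (∣κ∣≤κ₀ r (suc l) k (trans (ℕ.+-suc r l) eq))

  -- Lower bound at even index.

  -- slack h = r (r - 1) for r = 2 h, written through its increments 4 r + 2.
  slack : ℕ → ℚ
  slack zero    = 0ℚ
  slack (suc h) = slack h + (ι r + ι r + ι r + ι r + 1ℚ + 1ℚ)
    where r = h ℕ.* 2

  0≤slack : ∀ h → 0ℚ ≤ slack h
  0≤slack zero    = ℚ.≤-refl
  0≤slack (suc h) = 0≤-+ (0≤slack h) (0≤-+ (0≤-+ (0≤-+ (0≤-+ (0≤-+ 0≤r 0≤r) 0≤r) 0≤r)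
    (ℚ.nonNegative⁻¹ 1ℚ)) (ℚ.nonNegative⁻¹ 1ℚ))
    where 0≤r = 0≤ι (h ℕ.* 2)

  -- Up to terms bounded by b, passing from a₀ to a₂ multiplies by (d / n)² ∈ [0, 1].
  even-κ-step : ∀ {n d r s b a₋ a₀ a₁ a₂} → 0ℚ ℚ.< n → 0ℚ ≤ r → 0ℚ ≤ s →
    d * a₀ ≡ (n - r) * a₁ + r * a₋ →
    d * a₁ ≡ (n - (1ℚ + r)) * a₂ + (1ℚ + r) * a₀ →
    0ℚ ≤ n * n * b - d * d * b →
    0ℚ ≤ r * ((n * b + d * a₁) + (n * b - d * a₋)) →
    0ℚ ≤ (b + a₂) + (b - a₀) →
    0ℚ ≤ n * a₀ + s * b →
    0ℚ ≤ n * a₂ + (s + (r + r + r + r + 1ℚ + 1ℚ)) * b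
  even-κ-step {n} {d} {r} {s} {b} {a₋} {a₀} {a₁} {a₂} 0<n 0≤r 0≤s e₁ e₂ h₁ h₂ h₃ h₄ =
    -- Scaling by n² leaves room to substitute both recurrences, first for n a₂ and then for n a₁;
    -- what remains is a combination of `h₁` to `h₄` with nonnegative coefficients.
    0≤-cancel (*-pos 0<n 0<n) (subst (0ℚ ≤_) (sym identity)
      (0≤-+ (0≤-+ (0≤-* (0≤-square d) h₄) (0≤-* 0≤s h₁))
        (0≤-* (ℚ.<⇒≤ 0<n) (0≤-+ h₂ (0≤-* (0≤-* (0≤-+ (ℚ.nonNegative⁻¹ 1ℚ) 0≤r) (ℚ.<⇒≤ 0<n)) h₃)))))
    where
    n*a₁ : n * a₁ ≡ d * a₀ + r * (a₁ - a₋)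
    n*a₁ = trans (solve 4 (λ n r a c → n :* a := (n :- r) :* a :+ r :* c :+ r :* (a :- c))
      refl n r a₁ a₋) (cong (_+ r * (a₁ - a₋)) (sym e₁))
    n*a₂ : n * a₂ ≡ d * a₁ + (1ℚ + r) * (a₂ - a₀)
    n*a₂ = trans (solve 4 (λ n r a c → n :* a := (n :- r) :* a :+ r :* c :+ r :* (a :- c))
      refl n (1ℚ + r) a₂ a₀) (cong (_+ (1ℚ + r) * (a₂ - a₀)) (sym e₂))
    identity : n * n * (n * a₂ + (s + (r + r + r + r + 1ℚ + 1ℚ)) * b) ≡
      (d * d * (n * a₀ + s * b) + s * (n * n * b - d * d * b)) +
      n * (r * ((n * b + d * a₁) + (n * b - d * a₋)) + (1ℚ + r) * n * ((b + a₂) + (b - a₀)))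
    identity = begin
      n * n * (n * a₂ + (s + (r + r + r + r + 1ℚ + 1ℚ)) * b)
        ≡⟨ cong (λ x → n * n * (x + (s + (r + r + r + r + 1ℚ + 1ℚ)) * b)) n*a₂ ⟩
      n * n * ((d * a₁ + (1ℚ + r) * (a₂ - a₀)) + (s + (r + r + r + r + 1ℚ + 1ℚ)) * b)
        ≡⟨ solve 8 (λ n d r s b a₀ a₁ a₂ →
             n :* n :* ((d :* a₁ :+ (con 1ℚ :+ r) :* (a₂ :- a₀)) :+
               (s :+ (r :+ r :+ r :+ r :+ con 1ℚ :+ con 1ℚ)) :* b) :=
             d :* n :* (n :* a₁) :+ (n :* n :* (con 1ℚ :+ r) :* (a₂ :- a₀) :+
               n :* n :* (s :+ (r :+ r :+ r :+ r :+ con 1ℚ :+ con 1ℚ)) :* b))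
             refl n d r s b a₀ a₁ a₂ ⟩
      d * n * (n * a₁) + (n * n * (1ℚ + r) * (a₂ - a₀) +
        n * n * (s + (r + r + r + r + 1ℚ + 1ℚ)) * b)
        ≡⟨ cong (λ x → d * n * x + (n * n * (1ℚ + r) * (a₂ - a₀) +
             n * n * (s + (r + r + r + r + 1ℚ + 1ℚ)) * b)) n*a₁ ⟩
      d * n * (d * a₀ + r * (a₁ - a₋)) + (n * n * (1ℚ + r) * (a₂ - a₀) +
        n * n * (s + (r + r + r + r + 1ℚ + 1ℚ)) * b)
        ≡⟨ solve 9 (λ n d r s b a₋ a₀ a₁ a₂ →
             d :* n :* (d :* a₀ :+ r :* (a₁ :- a₋)) :+ (n :* n :* (con 1ℚ :+ r) :* (a₂ :- a₀) :+
               n :* n :* (s :+ (r :+ r :+ r :+ r :+ con 1ℚ :+ con 1ℚ)) :* b) :=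
             (d :* d :* (n :* a₀ :+ s :* b) :+ s :* (n :* n :* b :- d :* d :* b)) :+
             n :* (r :* ((n :* b :+ d :* a₁) :+ (n :* b :- d :* a₋)) :+
               (con 1ℚ :+ r) :* n :* ((b :+ a₂) :+ (b :- a₀))))
             refl n d r s b a₋ a₀ a₁ a₂ ⟩
      (d * d * (n * a₀ + s * b) + s * (n * n * b - d * d * b)) +
      n * (r * ((n * b + d * a₁) + (n * b - d * a₋)) + (1ℚ + r) * n * ((b + a₂) + (b - a₀))) ∎

  -- With `suc l` the `pred` in `weighted-κ` does not truncate, and `ι (suc l)` takes the form
  -- `ι n - ι r` that `even-κ-step` expects.
  three-term-recurrence : ∀ r l {n} k → r ℕ.+ suc l ≡ n → weighted (ι n) (κ r (suc l)) k ≡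
    (ι n - ι r) * κ (suc r) l k + ι r * κ (pred r) (suc (suc l)) k
  three-term-recurrence r l k refl = trans (weighted-κ r (suc l) k)
    (cong (λ x → x * κ (suc r) l k + ι r * κ (pred r) (suc (suc l)) k) (begin
      ι (suc l)                 ≡⟨ solve 2 (λ r l → l := r :+ l :- r) refl (ι r) (ι (suc l)) ⟩
      ι r + ι (suc l) - ι r     ≡⟨ cong (_- ι r) (ι-+ r (suc l)) ⟨
      ι (r ℕ.+ suc l) - ι r     ∎))

  -- The recurrence at r = 0 reads d κ₀ = n κ₁, so n times the bound d κ₁ ≤ n κ₀ is the claim. The
  -- factor κ₀ matters: d² ≤ n² fails for k > n, where κ₀ vanishes.
  0≤n²κ₀-d²κ₀ : ∀ n k → 0ℚ ≤ ι (suc n) * ι (suc n) * κ 0 (suc n) k -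
    weight (ι (suc n)) k * weight (ι (suc n)) k * κ 0 (suc n) k
  0≤n²κ₀-d²κ₀ n k = subst (0ℚ ≤_) identity
    (0≤-* (0≤ι (suc n)) (∣p∣≤q⇒0≤q-p (∣weighted-κ∣≤ 1 n k refl)))
    where
    N = ι (suc n)
    d = weight N k
    b = κ 0 (suc n) k
    identity : N * (N * b - d * κ 1 n k) ≡ N * N * b - d * d * b
    identity = begin
      N * (N * b - d * κ 1 n k)
        ≡⟨ solve 5 (λ N b d a c → N :* (N :* b :- d :* a) :=
             N :* N :* b :- d :* (N :* a :+ con 0ℚ :* c)) refl N b d (κ 1 n k) (κ 0 (2 ℕ.+ n) k) ⟩
      N * N * b - d * (N * κ 1 n k + ι 0 * κ 0 (2 ℕ.+ n) k)
        ≡⟨ cong (λ x → N * N * b - d * x) (weighted-κ 0 (suc n) k) ⟨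
      N * N * b - d * (d * b)
        ≡⟨ cong (λ x → N * N * b - x) (ℚ.*-assoc d d b) ⟨
      N * N * b - d * d * b ∎

  -- Induction on `h` with `n` fixed: two factors 1 - z are traded for two factors 1 + z, so the
  -- induction hypothesis is used at `2 + l`.
  even-κ-bound : ∀ h l {n} k → h ℕ.* 2 ℕ.+ l ≡ n →
    0ℚ ≤ ι n * κ (h ℕ.* 2) l k + slack h * κ 0 n k
  even-κ-bound zero    l k refl = 0≤-+ (0≤-* (0≤ι l) (0≤κ₀ l k))
    (ℚ.≤-reflexive (sym (ℚ.*-zeroˡ (κ 0 l k))))
  even-κ-bound (suc h) l {suc n} k refl = even-κ-step
    {d = weight (ι (suc n)) k} {a₋ = κ (pred r) (3 ℕ.+ l) k} {a₁ = κ (suc r) (suc l) k}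
    (0<ι-suc n) (0≤ι r) (0≤slack h)
    (three-term-recurrence r (suc l) k r+l+2)
    (trans (three-term-recurrence (suc r) l k r+1+l+1)
      (cong (λ x → (ι (suc n) - x) * κ (2 ℕ.+ r) l k + x * κ r (2 ℕ.+ l) k) (ι-suc r)))
    (0≤n²κ₀-d²κ₀ n k)
    (neighbours r r+l+2)
    (0≤-+ (∣p∣≤q⇒0≤q+p (∣κ∣≤κ₀ (2 ℕ.+ r) l k refl))
      (∣p∣≤q⇒0≤q-p (∣κ∣≤κ₀ r (2 ℕ.+ l) k r+l+2)))
    (even-κ-bound h (2 ℕ.+ l) k r+l+2)
    where
    r = h ℕ.* 2
    r+1+l+1 : suc r ℕ.+ suc l ≡ suc n
    r+1+l+1 = cong suc (ℕ.+-suc r l)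
    r+l+2 : r ℕ.+ (2 ℕ.+ l) ≡ suc n
    r+l+2 = trans (ℕ.+-suc r (suc l)) r+1+l+1
    -- For `r′ = 0` there is no neighbour of index r - 1, and the factor `ι r′` removes the term
    -- that `pred` would falsify.
    neighbours : ∀ r′ → r′ ℕ.+ (2 ℕ.+ l) ≡ suc n → 0ℚ ≤ ι r′ *
      ((ι (suc n) * κ 0 (suc n) k + weighted (ι (suc n)) (κ (suc r) (suc l)) k) +
       (ι (suc n) * κ 0 (suc n) k - weighted (ι (suc n)) (κ (pred r′) (3 ℕ.+ l)) k))
    neighbours zero     _  = ℚ.≤-reflexive (sym (ℚ.*-zeroˡ
      ((ι (suc n) * κ 0 (suc n) k + weighted (ι (suc n)) (κ (suc r) (suc l)) k) +
       (ι (suc n) * κ 0 (suc n) k - weighted (ι (suc n)) (κ 0 (3 ℕ.+ l)) k))))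
    neighbours (suc r′) eq = 0≤-* (0≤ι (suc r′)) (0≤-+
      (∣p∣≤q⇒0≤q+p (∣weighted-κ∣≤ (suc r) (suc l) k r+1+l+1))
      (∣p∣≤q⇒0≤q-p (∣weighted-κ∣≤ r′ (3 ℕ.+ l) k (trans (ℕ.+-suc r′ (2 ℕ.+ l)) eq))))

  -- With s = `slack h`, n (κ₀ + t κ) = (n - t s) κ₀ + t (n κ + s κ₀). The bound `T` makes one
  -- condition on `n` serve all `t ≤ T`.
  0≤κ₀+t*κ : ∀ h l {n T t} k → h ℕ.* 2 ℕ.+ l ≡ n → 0ℚ ℚ.< ι n → 0ℚ ≤ t → t ≤ T →
    T * slack h ≤ ι n → 0ℚ ≤ κ 0 n k + t * κ (h ℕ.* 2) l k
  0≤κ₀+t*κ h l {n} {T} {t} k eq 0<n 0≤t t≤T T*s≤n = 0≤-cancel 0<n (subst (0ℚ ≤_)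
    (solve 5 (λ n t s b a → (n :- t :* s) :* b :+ t :* (n :* a :+ s :* b) := n :* (b :+ t :* a))
      refl (ι n) t (slack h) (κ 0 n k) (κ (h ℕ.* 2) l k))
    (0≤-+ (0≤-* (≤⇒0≤- (ℚ.≤-trans
        (ℚ.*-monoʳ-≤-nonNeg (slack h) {{ℚ.nonNegative (0≤slack h)}} t≤T) T*s≤n)) (0≤κ₀ n k))
      (0≤-* 0≤t (even-κ-bound h l k eq))))

  -- Coefficients at the degree and above it.

  κ-vanishes : ∀ r l {k} → r ℕ.+ l ℕ.< k → κ r l k ≡ 0ℚ
  κ-vanishes zero    zero    {suc k} _  = refl
  κ-vanishes zero    (suc l) {suc k} lt =
    cong₂ _+_ (κ-vanishes 0 l (ℕ.<-trans (ℕ.n<1+n l) lt)) (κ-vanishes 0 l (ℕ.s<s⁻¹ lt))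
  κ-vanishes (suc r) l       {suc k} lt =
    cong₂ _-_ (κ-vanishes r l (ℕ.<-trans (ℕ.n<1+n (r ℕ.+ l)) lt)) (κ-vanishes r l (ℕ.s<s⁻¹ lt))

  κ₀-top : ∀ l → κ 0 l l ≡ 1ℚ
  κ₀-top zero    = refl
  κ₀-top (suc l) = cong₂ _+_ (κ-vanishes 0 l (ℕ.n<1+n l)) (κ₀-top l)

  κ-top-suc : ∀ r l → κ (suc r) l (suc r ℕ.+ l) ≡ - κ r l (r ℕ.+ l)
  κ-top-suc r l = trans (cong (_- κ r l (r ℕ.+ l)) (κ-vanishes r l (ℕ.n<1+n (r ℕ.+ l))))
    (ℚ.+-identityˡ (- κ r l (r ℕ.+ l)))

  κ-top-even : ∀ h l → κ (h ℕ.* 2) l (h ℕ.* 2 ℕ.+ l) ≡ 1ℚ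
  κ-top-even zero    l = κ₀-top l
  κ-top-even (suc h) l = trans (κ-top-suc (suc (h ℕ.* 2)) l)
    (cong -_ (trans (κ-top-suc (h ℕ.* 2) l) (cong -_ (κ-top-even h l))))

  κ-top-odd : ∀ h l → κ (suc (h ℕ.* 2)) l (suc (h ℕ.* 2 ℕ.+ l)) ≡ - 1ℚ
  κ-top-odd h l = trans (κ-top-suc (h ℕ.* 2) l) (cong -_ (κ-top-even h l))

  -- Products of generating functions.

  -- The Cauchy product, unfolded from the front and with a final `+ 0ℚ` so as to match `sum` over
  -- `Fin (suc k)` term by term.
  conv : (ℕ → ℚ) → (ℕ → ℚ) → ℕ → ℚ
  conv f g zero    = f 0 * g 0 + 0ℚ
  conv f g (suc k) = f 0 * g (suc k) + conv (f ∘ suc) g k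

  conv-cong : ∀ {f f′ g g′} → (∀ k → f k ≡ f′ k) → (∀ k → g k ≡ g′ k) →
    ∀ k → conv f g k ≡ conv f′ g′ k
  conv-cong f≗ g≗ zero    = cong (_+ 0ℚ) (cong₂ _*_ (f≗ 0) (g≗ 0))
  conv-cong f≗ g≗ (suc k) = cong₂ _+_ (cong₂ _*_ (f≗ 0) (g≗ (suc k))) (conv-cong (f≗ ∘ suc) g≗ k)

  conv-shiftʳ : ∀ f g k → conv f (shift g) k ≡ shift (conv f g) k
  conv-shiftʳ f g zero          = solve 1 (λ x → x :* con 0ℚ :+ con 0ℚ := con 0ℚ) refl (f 0)
  conv-shiftʳ f g (suc zero)    = cong (λ x → f 0 * g 0 + x) (conv-shiftʳ (f ∘ suc) g 0)
  conv-shiftʳ f g (suc (suc k)) = cong (λ x → f 0 * g (suc k) + x) (conv-shiftʳ (f ∘ suc) g (suc k))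

  conv-shiftˡ : ∀ f g k → conv (shift f) g k ≡ shift (conv f g) k
  conv-shiftˡ f g zero    = solve 1 (λ x → con 0ℚ :* x :+ con 0ℚ := con 0ℚ) refl (g 0)
  conv-shiftˡ f g (suc k) = trans (cong (_+ conv f g k) (ℚ.*-zeroˡ (g (suc k))))
    (ℚ.+-identityˡ (conv f g k))

  conv-+ʳ : ∀ f g g′ k → conv f (λ i → g i + g′ i) k ≡ conv f g k + conv f g′ k
  conv-+ʳ f g g′ zero    = solve 3 (λ x y z →
    x :* (y :+ z) :+ con 0ℚ := x :* y :+ con 0ℚ :+ (x :* z :+ con 0ℚ)) refl (f 0) (g 0) (g′ 0)
  conv-+ʳ f g g′ (suc k) = trans (cong (λ c → f 0 * (g (suc k) + g′ (suc k)) + c) (conv-+ʳ (f ∘ suc) g g′ k))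
    (solve 5 (λ x y z c c′ → x :* (y :+ z) :+ (c :+ c′) := (x :* y :+ c) :+ (x :* z :+ c′))
      refl (f 0) (g (suc k)) (g′ (suc k)) (conv (f ∘ suc) g k) (conv (f ∘ suc) g′ k))

  conv--ˡ : ∀ f f′ g k → conv (λ i → f i - f′ i) g k ≡ conv f g k - conv f′ g k
  conv--ˡ f f′ g zero    = solve 3 (λ x y z →
    (x :- y) :* z :+ con 0ℚ := (x :* z :+ con 0ℚ) :- (y :* z :+ con 0ℚ)) refl (f 0) (f′ 0) (g 0)
  conv--ˡ f f′ g (suc k) = trans (cong (λ c → (f 0 - f′ 0) * g (suc k) + c) (conv--ˡ (f ∘ suc) (f′ ∘ suc) g k))
    (solve 5 (λ x y z c c′ → (x :- y) :* z :+ (c :- c′) := (x :* z :+ c) :- (y :* z :+ c′))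
      refl (f 0) (f′ 0) (g (suc k)) (conv (f ∘ suc) g k) (conv (f′ ∘ suc) g k))

  -- Generalized binomial coefficients and the generating function of `K`.

  binomℚ : ℚ → ℕ → ℚ
  binomℚ x zero    = 1ℚ
  binomℚ x (suc j) = binomℚ x j * (x - ι j) * (+ 1 ℚ./ suc j)

  -- Each new factor 1 + x - (j + 1) on the left equals the factor x - j on the right. This prepares
  -- Pascal's rule for arbitrary rational `x`.
  binomℚ-absorb : ∀ x j → binomℚ (1ℚ + x) (suc j) ≡ (1ℚ + x) * binomℚ x j * (+ 1 ℚ./ suc j)
  binomℚ-absorb x zero    = solve 1 (λ x → con 1ℚ :* (con 1ℚ :+ x :- con 0ℚ) :* con 1ℚ :=
    (con 1ℚ :+ x) :* con 1ℚ :* con 1ℚ) refl x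
  binomℚ-absorb x (suc j) = cong (_* (+ 1 ℚ./ suc (suc j))) (begin
    binomℚ (1ℚ + x) (suc j) * (1ℚ + x - ι (suc j))
      ≡⟨ cong₂ (λ b i → b * (1ℚ + x - i)) (binomℚ-absorb x j) (ι-suc j) ⟩
    (1ℚ + x) * binomℚ x j * (+ 1 ℚ./ suc j) * (1ℚ + x - (1ℚ + ι j))
      ≡⟨ solve 4 (λ x b u i → (con 1ℚ :+ x) :* b :* u :* (con 1ℚ :+ x :- (con 1ℚ :+ i)) :=
           (con 1ℚ :+ x) :* (b :* (x :- i) :* u)) refl x (binomℚ x j) (+ 1 ℚ./ suc j) (ι j) ⟩
    (1ℚ + x) * binomℚ x (suc j) ∎)

  -- Split 1 + x as (x - j) + (1 + j) in the absorbed form: the first part gives the next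
  -- coefficient, the second cancels 1/(j + 1).
  binomℚ-pascal : ∀ x j → binomℚ (1ℚ + x) (suc j) ≡ binomℚ x (suc j) + binomℚ x j
  binomℚ-pascal x j = begin
    binomℚ (1ℚ + x) (suc j)
      ≡⟨ binomℚ-absorb x j ⟩
    (1ℚ + x) * binomℚ x j * u
      ≡⟨ solve 4 (λ x b u i → (con 1ℚ :+ x) :* b :* u :=
           b :* (x :- i) :* u :+ b :* (u :* (con 1ℚ :+ i))) refl x (binomℚ x j) u (ι j) ⟩
    binomℚ x (suc j) + binomℚ x j * (u * (1ℚ + ι j))
      ≡⟨ cong (λ y → binomℚ x (suc j) + binomℚ x j * y)
           (trans (cong (u *_) (sym (ι-suc j))) (ι-inverse j)) ⟩
    binomℚ x (suc j) + binomℚ x j * 1ℚ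
      ≡⟨ cong (λ y → binomℚ x (suc j) + y) (ℚ.*-identityʳ (binomℚ x j)) ⟩
    binomℚ x (suc j) + binomℚ x j ∎
    where
    u = + 1 ℚ./ suc j

  binomℚ-0 : ∀ k → binomℚ (ι 0) k ≡ κ 0 0 k
  binomℚ-0 zero          = refl
  binomℚ-0 (suc zero)    = refl
  binomℚ-0 (suc (suc k)) = trans
    (cong (λ b → b * (ι 0 - ι (suc k)) * (+ 1 ℚ./ suc (suc k))) (binomℚ-0 (suc k)))
    (solve 2 (λ x y → con 0ℚ :* x :* y := con 0ℚ) refl (ι 0 - ι (suc k)) (+ 1 ℚ./ suc (suc k)))

  sign : ℕ → ℚ
  sign zero    = 1ℚ
  sign (suc j) = (- 1ℚ) * sign j

  -- Coefficients of (1 - z)^x.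
  signed : ℚ → ℕ → ℚ
  signed x j = sign j * binomℚ x j

  signed-0 : ∀ k → signed (ι 0) k ≡ κ 0 0 k
  signed-0 zero    = refl
  signed-0 (suc k) = trans (cong (sign (suc k) *_) (binomℚ-0 (suc k))) (ℚ.*-zeroʳ (sign (suc k)))

  binomℚ-suc : ∀ l k → binomℚ (ι (suc l)) k ≡ times1+z (binomℚ (ι l)) k
  binomℚ-suc l zero    = refl
  binomℚ-suc l (suc k) = trans (cong (λ x → binomℚ x (suc k)) (ι-suc l)) (binomℚ-pascal (ι l) k)

  signed-suc : ∀ l k → signed (ι (suc l)) k ≡ times1-z (signed (ι l)) k
  signed-suc l zero    = refl
  signed-suc l (suc k) = trans (cong (sign (suc k) *_) (binomℚ-suc l (suc k)))
    (solve 3 (λ s x y → (:- con 1ℚ) :* s :* (x :+ y) := (:- con 1ℚ) :* s :* x :- s :* y)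
      refl (sign k) (binomℚ (ι l) (suc k)) (binomℚ (ι l) k))

  -- By Pascal's rule, raising `m` or `l` multiplies one factor of the convolution by 1 - z or 1 +
  -- z, which is the recursion of `κ`.
  conv-binomℚ : ∀ m l k → conv (signed (ι m)) (binomℚ (ι l)) k ≡ κ m l k
  conv-binomℚ zero zero k = trans (conv-cong signed-0 binomℚ-0 k) (unit k)
    where
    vanish : ∀ k → conv (λ _ → 0ℚ) (κ 0 0) k ≡ 0ℚ
    vanish zero    = refl
    vanish (suc k) = cong (λ x → 0ℚ * 0ℚ + x) (vanish k)
    unit : ∀ k → conv (κ 0 0) (κ 0 0) k ≡ κ 0 0 k
    unit zero    = refl
    unit (suc k) = cong (λ x → 1ℚ * 0ℚ + x) (vanish k)
  conv-binomℚ zero (suc l) k = begin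
    conv f (binomℚ (ι (suc l))) k                ≡⟨ conv-cong (λ _ → refl) (binomℚ-suc l) k ⟩
    conv f (times1+z g) k                        ≡⟨ conv-+ʳ f g (shift g) k ⟩
    conv f g k + conv f (shift g) k              ≡⟨ cong (λ x → conv f g k + x) (conv-shiftʳ f g k) ⟩
    conv f g k + shift (conv f g) k              ≡⟨ cong₂ _+_ (conv-binomℚ zero l k)
                                                      (shift-cong (conv-binomℚ zero l) k) ⟩
    κ 0 (suc l) k                                ∎
    where
    f = signed (ι 0)
    g = binomℚ (ι l)
  conv-binomℚ (suc m) l k = begin
    conv (signed (ι (suc m))) g k                ≡⟨ conv-cong (signed-suc m) (λ _ → refl) k ⟩
    conv (times1-z f) g k                        ≡⟨ conv--ˡ f (shift f) g k ⟩
    conv f g k - conv (shift f) g k              ≡⟨ cong (λ x → conv f g k - x) (conv-shiftˡ f g k) ⟩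
    conv f g k - shift (conv f g) k              ≡⟨ cong₂ _-_ (conv-binomℚ m l k)
                                                      (shift-cong (conv-binomℚ m l) k) ⟩
    κ (suc m) l k                                ∎
    where
    f = signed (ι m)
    g = binomℚ (ι l)

open Krawtchouk
open import Defs

-- Order on the reals through late stages of their rational approximations.

Eventually : (ℕ → Set) → Set
Eventually P = ∃[ N ] ∀ n → N ℕ.≤ n → P n

always : ∀ {P : ℕ → Set} → (∀ n → P n) → Eventually P
always p = 0 , λ n _ → p n

map₂ : ∀ {P Q R : ℕ → Set} → (∀ n → P n → Q n → R n) → Eventually P → Eventually Q → Eventually R
map₂ f (M , p) (N , q) = M ℕ.⊔ N , λ n h →
  f n (p n (ℕ.m⊔n≤o⇒m≤o M N h)) (q n (ℕ.m⊔n≤o⇒n≤o M N h))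

map₁ : ∀ {P Q : ℕ → Set} → (∀ n → P n → Q n) → Eventually P → Eventually Q
map₁ f (N , p) = N , λ n h → f n (p n h)

2ℚ : ℚ
2ℚ = + 2 ℚ./ 1

0≤1 : 0ℚ ℚ.≤ 1ℚ
0≤1 = ℚ.nonNegative⁻¹ 1ℚ

0≤-by : ∀ {p q} → q ≡ p → 0ℚ ℚ.≤ p → 0ℚ ℚ.≤ q
0≤-by eq = subst (0ℚ ℚ.≤_) (sym eq)

≤-by : ∀ {p q r} → q ℚ.- p ≡ r → 0ℚ ℚ.≤ r → p ℚ.≤ q
≤-by eq 0≤r = 0≤-⇒≤ (0≤-by eq 0≤r)

0≤q±p⇒∣p∣≤q : ∀ {p q} → 0ℚ ℚ.≤ q ℚ.- p → 0ℚ ℚ.≤ q ℚ.+ p → ℚ.∣ p ∣ ℚ.≤ q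
0≤q±p⇒∣p∣≤q {p} {q} h k with ℚ.∣p∣≡p∨∣p∣≡-p p
... | inj₁ e = subst (ℚ._≤ q) (sym e) (0≤-⇒≤ h)
... | inj₂ e = subst (ℚ._≤ q) (sym e)
  (≤-by (solve 2 (λ p q → q :- (:- p) := q :+ p) refl p q) k)

0≤-eventually : ∀ {x} → Eventually (λ N → 0ℚ ℚ.≤ seq x N) → 0ℝ ≤ x
0≤-eventually h = mk≤ λ ε 0<ε → map₁ (λ N 0≤x → 0≤-+ 0≤x (ℚ.<⇒≤ 0<ε)) h

-- Reduces an inequality of reals to a nonnegative certificate `z` and an identity of rationals at
-- each late stage, which the ring solver can treat.
≤-eventually : ∀ {x y z} → 0ℝ ≤ z → Eventually (λ N → seq y N ℚ.- seq x N ≡ seq z N) → x ≤ y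
≤-eventually {x} {y} {z} (mk≤ 0≤z) h = mk≤ λ ε 0<ε → map₂ (λ N e 0≤z+ε → ≤-by
  (trans (solve 3 (λ x y ε → y :+ ε :- x := y :- x :+ ε) refl (seq x N) (seq y N) ε)
    (cong (ℚ._+ ε) e)) 0≤z+ε) h (0≤z ε 0<ε)

≤⇒0≤ℝ- : ∀ {x y} → x ≤ y → 0ℝ ≤ y - x
≤⇒0≤ℝ- {x} {y} (mk≤ x≤y) = mk≤ λ ε 0<ε → map₁ (λ N h → 0≤-by
  (solve 3 (λ x y ε → y :- x :+ ε := y :+ ε :- x) refl (seq x N) (seq y N) ε) (≤⇒0≤- h)) (x≤y ε 0<ε)

0≤ℝ-+ : ∀ {x y} → 0ℝ ≤ x → 0ℝ ≤ y → 0ℝ ≤ x + y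
0≤ℝ-+ {x} {y} (mk≤ 0≤x) (mk≤ 0≤y) = mk≤ λ ε 0<ε → map₂ (λ N h k → 0≤-by
  (trans (cong (λ e → seq x N ℚ.+ seq y N ℚ.+ e) (sym (halves ε)))
    (solve 3 (λ x y e → x :+ y :+ (e :+ e) := (x :+ e) :+ (y :+ e)) refl
      (seq x N) (seq y N) (½ ℚ.* ε))) (0≤-+ h k))
  (0≤x (½ ℚ.* ε) (half-pos 0<ε)) (0≤y (½ ℚ.* ε) (half-pos 0<ε))

0≤ℝ-* : ∀ {x y} → 0ℝ ≤ x → 0ℝ ≤ y → 0ℝ ≤ x * y
0≤ℝ-* {x} {y} (mk≤ 0≤x) (mk≤ 0≤y) = mk≤ λ ε 0<ε →
  let B , 0<B , x≤B = bounded {seq x} (cauchy x)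
      C , 0<C , y≤C = bounded {seq y} (cauchy y)
      δ , 0<δ , Cδ = shrink C 0<C ε 0<ε
      η , 0<η , Bη = shrink B 0<B ε 0<ε
  in map₂ (λ N (x≤B , y≤C) (0≤x+δ , 0≤y+η) → bound {seq x N} {seq y N} {B} {C} (ℚ.<⇒≤ 0<B) (ℚ.<⇒≤ 0<δ) Cδ Bη
       (∣p∣≤q⇒0≤q-p x≤B) (∣p∣≤q⇒0≤q-p y≤C) 0≤x+δ 0≤y+η)
     (map₂ (λ _ → _,_) x≤B y≤C) (map₂ (λ _ → _,_) (0≤x δ 0<δ) (0≤y η 0<η))
  where
  bound : ∀ {x y B C δ η ε} → 0ℚ ℚ.≤ B → 0ℚ ℚ.≤ δ → C ℚ.* δ ≡ ε → B ℚ.* η ≡ ε →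
    0ℚ ℚ.≤ B ℚ.- x → 0ℚ ℚ.≤ C ℚ.- y → 0ℚ ℚ.≤ x ℚ.+ δ → 0ℚ ℚ.≤ y ℚ.+ η → 0ℚ ℚ.≤ x ℚ.* y ℚ.+ ε
  bound {x} {y} {B} {C} {δ} {η} 0≤B 0≤δ Cδ Bη x≤B y≤C -δ≤x -η≤y with ℚ.≤-total 0ℚ y
  -- A stage of a nonnegative real may be slightly negative, so the sign of `y` decides which factor
  -- is shifted: x + δ here, y + η in the other case.
  ... | inj₁ 0≤y = 0≤-by (trans (cong (x ℚ.* y ℚ.+_) (sym Cδ))
    (solve 4 (λ x y C δ → x :* y :+ C :* δ := (x :+ δ) :* y :+ δ :* (C :- y)) refl x y C δ))
    (0≤-+ (0≤-* -δ≤x 0≤y) (0≤-* 0≤δ y≤C))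
  ... | inj₂ y≤0 = 0≤-by (trans (cong (x ℚ.* y ℚ.+_) (sym Bη))
    (solve 4 (λ x y B η → x :* y :+ B :* η := (B :- x) :* (con 0ℚ :- y) :+ B :* (y :+ η)) refl x y B η))
    (0≤-+ (0≤-* x≤B (≤⇒0≤- y≤0)) (0≤-* 0≤B -η≤y))

0≤ℝ-sum : ∀ {n} (f : Fin n → ℝ) → (∀ p → 0ℝ ≤ f p) → 0ℝ ≤ sum f
0≤ℝ-sum {zero}  f 0≤f = 0≤-eventually (always λ _ → ℚ.≤-refl)
0≤ℝ-sum {suc n} f 0≤f = 0≤ℝ-+ (0≤f zero) (0≤ℝ-sum (f ∘ suc) (0≤f ∘ suc))

-- Stagewise evaluation of sums and of Krawtchouk polynomials.

seq-sum-comb : ∀ {n} (f g h : Fin n → ℝ) α N →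
  (∀ p → seq (h p) N ≡ seq (f p) N ℚ.+ α ℚ.* seq (g p) N) →
  seq (sum h) N ≡ seq (sum f) N ℚ.+ α ℚ.* seq (sum g) N
seq-sum-comb {zero}  f g h α N eq = solve 1 (λ α → con 0ℚ := con 0ℚ :+ α :* con 0ℚ) refl α
seq-sum-comb {suc n} f g h α N eq = trans
  (cong₂ ℚ._+_ (eq zero) (seq-sum-comb (f ∘ suc) (g ∘ suc) (h ∘ suc) α N (eq ∘ suc)))
  (solve 5 (λ x y α s t → (x :+ α :* y) :+ (s :+ α :* t) := (x :+ s) :+ α :* (y :+ t)) refl
    (seq (f zero) N) (seq (g zero) N) α (seq (sum (f ∘ suc)) N) (seq (sum (g ∘ suc)) N))

seq-sum-zero : ∀ {n} (f : Fin n → ℝ) N → (∀ p → seq (f p) N ≡ 0ℚ) → seq (sum f) N ≡ 0ℚ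
seq-sum-zero {zero}  f N eq = refl
seq-sum-zero {suc n} f N eq = cong₂ ℚ._+_ (eq zero) (seq-sum-zero (f ∘ suc) N (eq ∘ suc))

seq-conv : ∀ (F G : ℕ → ℝ) k N → seq (sum {suc k} λ j → F (toℕ j) * G (k ∸ toℕ j)) N ≡
  conv (λ j → seq (F j) N) (λ j → seq (G j) N) k
seq-conv F G zero    N = refl
seq-conv F G (suc k) N = cong (seq (F 0) N ℚ.* seq (G (suc k)) N ℚ.+_) (seq-conv (F ∘ suc) G k N)

seq-binom : ∀ x j N → seq (binom x j) N ≡ binomℚ (seq x N) j
seq-binom x zero    N = refl
seq-binom x (suc j) N =
  cong (λ b → b ℚ.* (seq x N ℚ.- ι j) ℚ.* (+ 1 ℚ./ suc j)) (seq-binom x j N)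

seq-sign : ∀ j N → seq ((- 1ℝ) ^ j) N ≡ sign j
seq-sign zero    N = refl
seq-sign (suc j) N = cong ((ℚ.- 1ℚ) ℚ.*_) (seq-sign j N)

-- For an integer argument all stages are the same rational, read off the generating function with l
-- = n - i.
seq-K : ∀ i l {n} k N → i ℕ.+ l ≡ n → seq (K n k (fromℕ i)) N ≡ κ i l k
seq-K i l {n} k N refl = trans
  (seq-conv (λ j → (- 1ℝ) ^ j * binom (fromℕ i) j) (binom (fromℕ n - fromℕ i)) k N)
  (trans (conv-cong (λ j → cong₂ ℚ._*_ (seq-sign j N) (seq-binom (fromℕ i) j N))
      (λ j → trans (seq-binom (fromℕ n - fromℕ i) j N) (cong (λ x → binomℚ x j) n-i)) k)
    (conv-binomℚ i l k))
  where
  n-i : ι (i ℕ.+ l) ℚ.- ι i ≡ ι l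
  n-i = trans (cong (ℚ._- ι i) (ι-+ i l)) (solve 2 (λ i l → i :+ l :- i := l) refl (ι i) (ι l))

-- Reciprocals of `a` and `2a`.

0≤invℚ : ∀ {q} → 0ℚ ℚ.< q → 0ℚ ℚ.≤ invℚ q
0≤invℚ {q} 0<q = 0≤-cancel 0<q (0≤-by (invℚ-inverseʳ q 0<q) 0≤1)

invℚ-2* : ∀ {q} → 0ℚ ℚ.< q → invℚ (2ℚ ℚ.* q) ℚ.+ invℚ (2ℚ ℚ.* q) ≡ invℚ q
invℚ-2* {q} 0<q = begin
  b ℚ.+ b                     ≡⟨ ℚ.*-identityʳ (b ℚ.+ b) ⟨
  (b ℚ.+ b) ℚ.* 1ℚ            ≡⟨ cong ((b ℚ.+ b) ℚ.*_) (invℚ-inverseʳ q 0<q) ⟨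
  (b ℚ.+ b) ℚ.* (q ℚ.* t)     ≡⟨ solve 3 (λ b q t → (b :+ b) :* (q :* t) := (con 2ℚ :* q) :* b :* t)
                                   refl b q t ⟩
  2ℚ ℚ.* q ℚ.* b ℚ.* t        ≡⟨ cong (ℚ._* t) (invℚ-inverseʳ (2ℚ ℚ.* q) (*-pos (ℚ.positive⁻¹ 2ℚ) 0<q)) ⟩
  1ℚ ℚ.* t                    ≡⟨ ℚ.*-identityˡ t ⟩
  t                           ∎
  where
  open ≡-Reasoning
  b = invℚ (2ℚ ℚ.* q)
  t = invℚ q

eventually-pos : ∀ {x} → 0ℝ < x → Eventually (λ N → 0ℚ ℚ.< seq x N)
eventually-pos {x} (mk< δ 0<δ δ≤x) = map₁ (λ N h →
  ℚ.<-≤-trans 0<δ (subst (ℚ._≤ seq x N) (ℚ.+-identityˡ δ) h)) δ≤x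

-- `T` is common to all late stages, so a threshold on the dimension can be chosen before the stage.
reciprocal-bounds : ∀ {a} (0<a : 0ℝ < a) → a ≤ fromℚ ½ →
  ∃[ T ] Eventually (λ N → 0ℚ ℚ.≤ invℚ (seq a N) ℚ.- 1ℚ × invℚ (seq a N) ℚ.- 1ℚ ℚ.≤ T)
reciprocal-bounds {a} 0<a (mk≤ a≤½) = proj₁ above , map₂ (λ _ → _,_)
  -- Precision ½ turns `a ≤ ½` into a bound by 1 at late stages, which suffices for 1/a - 1 ≥ 0.
  (map₂ (λ _ → lower) (eventually-pos 0<a) (a≤½ ½ (ℚ.positive⁻¹ ½)))
  (map₁ (λ _ → upper) (proj₂ (proj₂ above)))
  where
  above : ∃[ T ] 0ℚ ℚ.< T × Eventually (λ N → ℚ.∣ invℚ (seq a N) ∣ ℚ.≤ T)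
  above = bounded (cauchy (1/ a [ 0<a ]))
  lower : ∀ {q} → 0ℚ ℚ.< q → q ℚ.≤ 1ℚ → 0ℚ ℚ.≤ invℚ q ℚ.- 1ℚ
  lower {q} 0<q q≤1 = 0≤-cancel 0<q (0≤-by (trans
    (solve 2 (λ a t → a :* (t :- con 1ℚ) := a :* t :- a) refl q (invℚ q))
    (cong (ℚ._- q) (invℚ-inverseʳ q 0<q))) (≤⇒0≤- q≤1))
  upper : ∀ {t T} → ℚ.∣ t ∣ ℚ.≤ T → t ℚ.- 1ℚ ℚ.≤ T
  upper {t} {T} ∣t∣≤T = ≤-by (solve 2 (λ t T → T :- (t :- con 1ℚ) := (T :- t) :+ con 1ℚ) refl t T)
    (0≤-+ (∣p∣≤q⇒0≤q-p ∣t∣≤T) 0≤1)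

-- With b = 1/(2a), b - 1 = b · 2(½ - a). Nonnegativity comes from a product of reals, since single
-- stages of `a` may exceed ½.
0≤1/2a-1 : ∀ {a} (0<a : 0ℝ < a) → a ≤ fromℚ ½ → 0ℝ ≤ 1/ (2ℝ * a) [ 2*-pos {a} 0<a ] - 1ℝ
0≤1/2a-1 {a} 0<a a≤½ = ≤-eventually
  (0≤ℝ-* {1/ (2ℝ * a) [ 2*-pos {a} 0<a ]} {2ℝ * (fromℚ ½ - a)}
    (0≤-eventually (map₁ (λ _ → 0≤invℚ) 0<2a))
    (0≤ℝ-* {2ℝ} (0≤-eventually (always λ _ → ℚ.nonNegative⁻¹ 2ℚ)) (≤⇒0≤ℝ- a≤½)))
  (map₁ (λ N 0<2aₙ → sym (trans
    (solve 2 (λ b a → b :* (con 2ℚ :* (con ½ :- a)) := b :- (con 2ℚ :* a) :* b) refl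
      (invℚ (2ℚ ℚ.* seq a N)) (seq a N))
    (trans (cong (λ x → invℚ (2ℚ ℚ.* seq a N) ℚ.- x) (invℚ-inverseʳ (2ℚ ℚ.* seq a N) 0<2aₙ))
      (solve 1 (λ b → b :- con 1ℚ := b :- con 1ℚ :- con 0ℚ) refl (invℚ (2ℚ ℚ.* seq a N)))))) 0<2a)
  where
  0<2a : Eventually (λ N → 0ℚ ℚ.< 2ℚ ℚ.* seq a N)
  0<2a = eventually-pos {2ℝ * a} (2*-pos {a} 0<a)

-- From an attained optimum to the limit.

<⇒≤ℝ : ∀ {x y} → x < y → x ≤ y
<⇒≤ℝ {x} {y} (mk< δ 0<δ x<y) = mk≤ λ ε 0<ε → map₁ (λ N h → ≤-by
  (solve 4 (λ x y δ ε → y :+ ε :- x := (y :- (x :+ δ)) :+ (δ :+ ε)) refl (seq x N) (seq y N) δ ε)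
  (0≤-+ (≤⇒0≤- h) (0≤-+ (ℚ.<⇒≤ 0<δ) (ℚ.<⇒≤ 0<ε)))) x<y

≤ℝ-trans : ∀ {x y z} → x ≤ y → y ≤ z → x ≤ z
≤ℝ-trans {x} {y} {z} x≤y y≤z = ≤-eventually
  (0≤ℝ-+ (≤⇒0≤ℝ- x≤y) (≤⇒0≤ℝ- y≤z))
  (always λ N → solve 3 (λ x y z → z :- x := (y :- x) :+ (z :- y)) refl (seq x N) (seq y N) (seq z N))

<-≤ℝ-trans : ∀ {x y z} → x < y → y ≤ z → x < z
<-≤ℝ-trans {x} {y} {z} (mk< δ 0<δ x<y) (mk≤ y≤z) = mk< (½ ℚ.* δ) (half-pos 0<δ)
  (map₂ (λ N x+δ≤y y≤z+½δ → ≤-by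
    (trans (solve 4 (λ x y z e → z :- (x :+ e) := (y :- (x :+ (e :+ e))) :+ ((z :+ e) :- y)) refl
      (seq x N) (seq y N) (seq z N) (½ ℚ.* δ))
      (cong (λ d → (seq y N ℚ.- (seq x N ℚ.+ d)) ℚ.+ ((seq z N ℚ.+ ½ ℚ.* δ) ℚ.- seq y N)) (halves δ)))
    (0≤-+ (≤⇒0≤- x+δ≤y) (≤⇒0≤- y≤z+½δ))) x<y (y≤z (½ ℚ.* δ) (half-pos 0<δ)))

x-η<x : ∀ {x η} → 0ℚ ℚ.< η → x - fromℚ η < x
x-η<x {x} {η} 0<η = mk< η 0<η (always λ N → ℚ.≤-reflexive
  (solve 2 (λ x η → x :- η :+ η := x) refl (seq x N) η))

-- Each real inequality costs another η at late stages, so the distance is at most 2η there; the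
-- other 2η is the gap that `<` requires.
close⇒∣x-y∣<ε : ∀ {x y η ε} → 0ℚ ℚ.< η → x - fromℚ η ≤ y → y ≤ x →
  Eventually (λ N → η ℚ.+ η ℚ.+ (η ℚ.+ η) ℚ.≤ seq ε N) → ∣ x - y ∣ < ε
close⇒∣x-y∣<ε {x} {y} {η} {ε} 0<η (mk≤ x-η≤y) (mk≤ y≤x) 4η≤ε = mk< (η ℚ.+ η) (ℚ.+-mono-< 0<η 0<η)
  (map₂ (λ N (h , k) 4η≤ε → ℚ.≤-trans (ℚ.+-monoˡ-≤ (η ℚ.+ η) (0≤q±p⇒∣p∣≤q {seq x N ℚ.- seq y N} {η ℚ.+ η}
      (0≤-by (solve 3 (λ x y η → (η :+ η) :- (x :- y) := (y :+ η) :- (x :- η)) refl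
        (seq x N) (seq y N) η) (≤⇒0≤- h))
      (0≤-by (solve 3 (λ x y η → (η :+ η) :+ (x :- y) := (x :+ η :- y) :+ η) refl
        (seq x N) (seq y N) η) (0≤-+ (≤⇒0≤- k) (ℚ.<⇒≤ 0<η))))) 4η≤ε)
    (map₂ (λ _ → _,_) (x-η≤y η 0<η) (y≤x η 0<η)) 4η≤ε)

attained⇒TendsTo : ∀ m a (0<a : 0ℝ < a) l N →
  (∀ n → N ℕ.≤ n → (∀ x → LP.Feasible m n a 0<a x → LP.objective m n a 0<a x ≤ l) ×
    ∃[ x ] LP.Feasible m n a 0<a x × l ≤ LP.objective m n a 0<a x) →
  (λ n → LP.IsOptimalValue m n a 0<a) TendsTo l
attained⇒TendsTo m a 0<a l N attained ε (mk< δ 0<δ δ≤ε) = N , λ n N≤n →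
  let upper , x* , feasible , l≤x* = attained n N≤n in
  (l , upper , λ w w<l → x* , feasible , <-≤ℝ-trans w<l l≤x*) ,
  λ v (v-upper , v-least) →
    -- `v` is a supremum: some feasible point exceeds `v - η`, whence `v - η ≤ l`, while the value
    -- at `x*` gives `l ≤ v`.
    let x , x-feasible , v-η<x = v-least (v - fromℚ η) (x-η<x 0<η)
    in close⇒∣x-y∣<ε {v} {l} {η} 0<η (≤ℝ-trans (<⇒≤ℝ v-η<x) (upper x x-feasible))
         (≤ℝ-trans l≤x* (v-upper x* feasible)) 4η≤ε
  where
  η : ℚ
  η = ½ ℚ.* (½ ℚ.* δ)
  0<η : 0ℚ ℚ.< η
  0<η = half-pos (half-pos 0<δ)
  4η≤ε : Eventually (λ N → η ℚ.+ η ℚ.+ (η ℚ.+ η) ℚ.≤ seq ε N)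
  4η≤ε = map₁ (λ N δ≤ε → subst (ℚ._≤ seq ε N)
    (trans (ℚ.+-identityˡ δ) (trans (sym (halves δ)) (sym (cong₂ ℚ._+_ (halves (½ ℚ.* δ)) (halves (½ ℚ.* δ))))))
    δ≤ε) δ≤ε

-- Sign of the even coefficients in large dimension.

ι-mono : ∀ {m n} → m ℕ.≤ n → ι m ℚ.≤ ι n
ι-mono {m} {n} m≤n = ≤-by (trans (cong (λ k → ι k ℚ.- ι m) (sym (ℕ.m+[n∸m]≡n m≤n)))
  (trans (cong (ℚ._- ι m) (ι-+ m (n ∸ m)))
    (solve 2 (λ x y → x :+ y :- x := y) refl (ι m) (ι (n ∸ m))))) (0≤ι (n ∸ m))

module _ (a : ℝ) (0<a : 0ℝ < a) (a≤½ : a ≤ fromℚ ½) (h : ℕ) where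

  private
    T = proj₁ (reciprocal-bounds 0<a a≤½)
    t-bounds = proj₂ (reciprocal-bounds 0<a a≤½)
    M = proj₁ (ι-archimedean (T ℚ.* slack h))
    T*slack≤ = proj₂ (ι-archimedean (T ℚ.* slack h))

  -- `M` dominates `T * slack h`, `h * 2` leaves room for l = n - 2h, and the successor makes the
  -- dimension positive.
  threshold : ℕ
  threshold = suc (M ℕ.⊔ h ℕ.* 2)

  -- These are the objective coefficients, up to sign, for m = 2h; one dimension lower they enter
  -- the reduced costs for m = 2h + 1.
  0≤even-coefficient : ∀ {n} l k → threshold ℕ.≤ n → h ℕ.* 2 ℕ.+ l ≡ n →
    Eventually (λ N → 0ℚ ℚ.≤ κ 0 n k ℚ.+ (invℚ (seq a N) ℚ.- 1ℚ) ℚ.* κ (h ℕ.* 2) l k)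
  0≤even-coefficient {suc n} l k (ℕ.s≤s le) eq = map₁
    (λ N (0≤t , t≤T) → 0≤κ₀+t*κ h l k eq (0<ι-suc n) 0≤t t≤T
      (ℚ.≤-trans T*slack≤ (ι-mono (ℕ.≤-trans (ℕ.m⊔n≤o⇒m≤o M (h ℕ.* 2) le) (ℕ.n≤1+n n)))))
    t-bounds

  threshold⇒h*2≤ : ∀ {n} → threshold ℕ.≤ n → h ℕ.* 2 ℕ.≤ n
  threshold⇒h*2≤ le = ℕ.≤-trans (ℕ.m≤n⊔m M (h ℕ.* 2)) (ℕ.≤-trans (ℕ.n≤1+n (M ℕ.⊔ h ℕ.* 2)) le)

-- Even `m`: the origin is optimal.

even-limit : ∀ a (0<a : 0ℝ < a) → a ≤ fromℚ ½ → ∀ h →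
  (λ n → LP.IsOptimalValue (h ℕ.* 2) n a 0<a) TendsTo 0ℝ
even-limit a 0<a a≤½ h = attained⇒TendsTo m a 0<a 0ℝ (threshold a 0<a a≤½ h) λ n N≤n →
  let m+l≡n = ℕ.m+[n∸m]≡n (threshold⇒h*2≤ a 0<a a≤½ h N≤n)
      c : Fin n → ℝ
      c p = K n (suc (toℕ p)) 0ℝ + (1/ a [ 0<a ] - 1ℝ) * K n (suc (toℕ p)) (fromℕ m)
      0≤c : ∀ p → 0ℝ ≤ c p
      0≤c p = 0≤-eventually (map₁
        (λ N → 0≤-by (cong₂ (λ x y → x ℚ.+ (invℚ (seq a N) ℚ.- 1ℚ) ℚ.* y)
          (seq-K 0 n (suc (toℕ p)) N refl) (seq-K m (n ∸ m) (suc (toℕ p)) N m+l≡n)))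
        (0≤even-coefficient a 0<a a≤½ h (n ∸ m) (suc (toℕ p)) N≤n m+l≡n))
      sum-zero : ∀ (f : Fin n → ℝ) N → seq (sum λ p → f p * 0ℝ) N ≡ 0ℚ
      sum-zero f N = seq-sum-zero (λ p → f p * 0ℝ) N (λ p → ℚ.*-zeroʳ (seq (f p) N))
  in
  (λ x (0≤x , _) → ≤-eventually (0≤ℝ-sum (λ p → c p * x p) (λ p → 0≤ℝ-* (0≤c p) (0≤x p)))
    (always λ N → solve 1 (λ s → con 0ℚ :- (:- s) := s) refl (seq (sum (λ p → c p * x p)) N))) ,
  (λ _ → 0ℝ) ,
  ((λ _ → 0≤-eventually (always λ _ → ℚ.≤-refl)) ,
   λ i _ → ≤-eventually {z = 1ℝ} (0≤-eventually (always λ _ → 0≤1))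
     (always λ N → cong (ℚ._- (ℚ.- 1ℚ)) (sum-zero (λ p → K n (suc (toℕ p)) (fromℕ m) - K n (suc (toℕ p)) (fromℕ i)) N))) ,
  ≤-eventually {z = 0ℝ} (0≤-eventually (always λ _ → ℚ.≤-refl))
    (always λ N → cong (λ s → (ℚ.- s) ℚ.- 0ℚ) (sum-zero c N))
  where
  m = h ℕ.* 2

-- Odd `m`: primal point and dual certificate.

-- For `m` odd the value ½ makes the constraints with `i` even tight, since K_n(m) - K_n(i) is then
-- -2.
lastHalf : ∀ n → Fin (suc n) → ℚ
lastHalf zero    zero    = ½
lastHalf (suc n) zero    = 0ℚ
lastHalf (suc n) (suc p) = lastHalf n p

0≤lastHalf : ∀ n p → 0ℚ ℚ.≤ lastHalf n p
0≤lastHalf zero    zero    = ℚ.nonNegative⁻¹ ½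
0≤lastHalf (suc n) zero    = ℚ.≤-refl
0≤lastHalf (suc n) (suc p) = 0≤lastHalf n p

seq-sum-lastHalf : ∀ n (F : ℕ → ℝ) N →
  seq (sum {suc n} λ p → F (suc (toℕ p)) * fromℚ (lastHalf n p)) N ≡ seq (F (suc n)) N ℚ.* ½
seq-sum-lastHalf zero    F N = ℚ.+-identityʳ (seq (F 1) N ℚ.* ½)
seq-sum-lastHalf (suc n) F N = trans
  (cong₂ ℚ._+_ (ℚ.*-zeroʳ (seq (F 1) N)) (seq-sum-lastHalf n (F ∘ suc) N))
  (ℚ.+-identityˡ (seq (F (suc (suc n))) N ℚ.* ½))

odd-limit : ∀ a (0<a : 0ℝ < a) → a ≤ fromℚ ½ → ∀ h → 1 ℕ.≤ h ℕ.* 2 →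
  (λ n → LP.IsOptimalValue (suc (h ℕ.* 2)) n a 0<a) TendsTo (1/ (2ℝ * a) [ 2*-pos {a} 0<a ] - 1ℝ)
odd-limit a 0<a a≤½ h 1≤r = attained⇒TendsTo m a 0<a β (suc (threshold a 0<a a≤½ h)) attained
  where
  r = h ℕ.* 2
  m = suc r
  β = 1/ (2ℝ * a) [ 2*-pos {a} 0<a ] - 1ℝ
  t b : ℕ → ℚ
  t N = invℚ (seq a N)
  b N = invℚ (2ℚ ℚ.* seq a N)
  b+b≡t : Eventually (λ N → b N ℚ.+ b N ≡ t N)
  b+b≡t = map₁ (λ _ → invℚ-2*) (eventually-pos 0<a)
  attained : ∀ n → suc (threshold a 0<a a≤½ h) ℕ.≤ n →
    (∀ x → LP.Feasible m n a 0<a x → LP.objective m n a 0<a x ≤ β) ×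
    ∃[ x ] LP.Feasible m n a 0<a x × β ≤ LP.objective m n a 0<a x
  -- The threshold must hold for `n′` = n - 1, the dimension to which Pascal's rule lowers the
  -- reduced costs; hence the extra `suc`.
  attained (suc n′) (ℕ.s≤s N≤n′) = upper , x* , (0≤x* , x*-constraint) , β≤x*
    where
    n = suc n′
    -- Also n - m: thus `κ m l` and `κ r (suc l)` belong to dimension `n`, and `κ r l` to `n′`.
    l = n′ ∸ r
    r≤n′ = threshold⇒h*2≤ a 0<a a≤½ h N≤n′
    r+l≡n′ : r ℕ.+ l ≡ n′
    r+l≡n′ = ℕ.m+[n∸m]≡n r≤n′
    c d e : ℕ → ℝ
    c k = K n k 0ℝ + (1/ a [ 0<a ] - 1ℝ) * K n k (fromℕ m)
    d k = K n k (fromℕ m) - K n k (fromℕ r)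
    e k = c k - β * d k  -- reduced cost under multiplier β on the constraint i = r
    seq-c : ∀ k N → seq (c k) N ≡ κ 0 n k ℚ.+ (t N ℚ.- 1ℚ) ℚ.* κ m l k
    seq-c k N = cong₂ (λ x y → x ℚ.+ (t N ℚ.- 1ℚ) ℚ.* y)
      (seq-K 0 n k N refl) (seq-K m l k N (cong suc r+l≡n′))
    seq-d : ∀ k N → seq (d k) N ≡ κ m l k ℚ.- κ r (suc l) k
    seq-d k N = cong₂ ℚ._-_ (seq-K m l k N (cong suc r+l≡n′))
      (seq-K r (suc l) k N (trans (ℕ.+-suc r l) (cong suc r+l≡n′)))
    seq-e : ∀ j N → b N ℚ.+ b N ≡ t N → seq (e (suc j)) N ≡
      (κ 0 n′ (suc j) ℚ.+ (t N ℚ.- 1ℚ) ℚ.* κ r l (suc j)) ℚ.+ (κ 0 n′ j ℚ.- κ r l j)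
    seq-e j N b+b≡t = trans
      (cong₂ (λ x y → x ℚ.- (b N ℚ.- 1ℚ) ℚ.* y) (seq-c (suc j) N)
        (trans (seq-d (suc j) N) (cong (λ x → κ m l (suc j) ℚ.- x) (κ-sucʳ r l (suc j)))))
      (trans (cong (λ t → (κ 0 n (suc j) ℚ.+ (t ℚ.- 1ℚ) ℚ.* κ m l (suc j)) ℚ.-
          (b N ℚ.- 1ℚ) ℚ.* (κ m l (suc j) ℚ.- times1+z (κ r l) (suc j))) (sym b+b≡t))
        -- `A - A′` is `κ m l` and `A + A′` is `κ r (suc l)` at `suc j`; substituting t = 2b leaves
        -- just `- A′` from the terms in `A′`.
        (trans (solve 5 (λ b B B′ A A′ →
            ((B :+ B′) :+ (b :+ b :- con 1ℚ) :* (A :- A′)) :-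
              (b :- con 1ℚ) :* ((A :- A′) :- (A :+ A′)) :=
            (B :+ (b :+ b :- con 1ℚ) :* A) :+ (B′ :- A′)) refl
            (b N) (κ 0 n′ (suc j)) (κ 0 n′ j) (κ r l (suc j)) (κ r l j))
          (cong (λ t → (κ 0 n′ (suc j) ℚ.+ (t ℚ.- 1ℚ) ℚ.* κ r l (suc j)) ℚ.+
            (κ 0 n′ j ℚ.- κ r l j)) b+b≡t)))
    0≤e : ∀ j → 0ℝ ≤ e (suc j)
    0≤e j = 0≤-eventually (map₂
      (λ N eq 0≤x → 0≤-by (seq-e j N eq) (0≤-+ 0≤x (∣p∣≤q⇒0≤q-p (∣κ∣≤κ₀ r l j r+l≡n′))))
      b+b≡t (0≤even-coefficient a 0<a a≤½ h l (suc j) N≤n′ r+l≡n′))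
    upper : ∀ x → LP.Feasible m n a 0<a x → LP.objective m n a 0<a x ≤ β
    -- Weak duality: with S the sum of c x and D the left side of the constraint i = r, β + S = β (D
    -- + 1) + (S - β D), and S - β D is the sum of e x.
    upper x (0≤x , constraint) = ≤-eventually
      (0≤ℝ-+ (0≤ℝ-* (0≤1/2a-1 0<a a≤½)
          (≤⇒0≤ℝ- (constraint r (inj₁ (1≤r , ℕ.n<1+n r)))))
        (0≤ℝ-sum (λ p → e (suc (toℕ p)) * x p) (λ p → 0≤ℝ-* (0≤e (toℕ p)) (0≤x p))))
      (always λ N → trans
        (solve 3 (λ β S D → β :- (:- S) :=
            β :* (D :- (:- con 1ℚ)) :+ (S :+ (:- β) :* D)) refl
          (seq β N) (seq (sum λ p → c (suc (toℕ p)) * x p) N) (seq (sum λ p → d (suc (toℕ p)) * x p) N))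
        (cong (λ s → seq β N ℚ.* (seq (sum λ p → d (suc (toℕ p)) * x p) N ℚ.- (ℚ.- 1ℚ)) ℚ.+ s)
          (sym (seq-sum-comb (λ p → c (suc (toℕ p)) * x p) (λ p → d (suc (toℕ p)) * x p)
            (λ p → e (suc (toℕ p)) * x p) (ℚ.- seq β N) N
            (λ p → solve 4 (λ c β d x → (c :- β :* d) :* x := c :* x :+ (:- β) :* (d :* x)) refl
              (seq (c (suc (toℕ p))) N) (seq β N) (seq (d (suc (toℕ p))) N) (seq (x p) N))))))
    κ-top : κ m l n ≡ ℚ.- 1ℚ
    κ-top = subst (λ k → κ m l (suc k) ≡ ℚ.- 1ℚ) r+l≡n′ (κ-top-odd h l)
    x* : Fin n → ℝ
    x* p = fromℚ (lastHalf n′ p)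
    0≤x* : ∀ p → 0ℝ ≤ x* p
    0≤x* p = 0≤-eventually (always λ _ → 0≤lastHalf n′ p)
    x*-constraint : ∀ i → (1 ℕ.≤ i × i ℕ.< m) ⊎ (m ℕ.< i × i ℕ.≤ n) →
      - 1ℝ ≤ sum {n} λ p → (K n (suc (toℕ p)) (fromℕ m) - K n (suc (toℕ p)) (fromℕ i)) * x* p
    -- As K_n(m) = -1, the margin in the constraint is ½ (1 - K_n(i)), nonnegative because the
    -- absolute value of K_n(i) is at most C(n,n) = 1.
    x*-constraint i i-range = ≤-eventually {z = fromℚ (½ ℚ.* (1ℚ ℚ.- κ i (n ∸ i) n))}
      (0≤-eventually (always λ _ → 0≤-* (ℚ.nonNegative⁻¹ ½)
        (∣p∣≤q⇒0≤q-p (subst (ℚ.∣ κ i (n ∸ i) n ∣ ℚ.≤_) (κ₀-top n) (∣κ∣≤κ₀ i (n ∸ i) n i+[n∸i]≡n)))))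
      (always λ N → trans
        (cong (ℚ._- (ℚ.- 1ℚ)) (trans
          (seq-sum-lastHalf n′ (λ k → K n k (fromℕ m) - K n k (fromℕ i)) N)
          (cong (ℚ._* ½) (cong₂ ℚ._-_
            (trans (seq-K m l n N (cong suc r+l≡n′)) κ-top) (seq-K i (n ∸ i) n N i+[n∸i]≡n)))))
        (solve 1 (λ x → (:- con 1ℚ :- x) :* con ½ :- (:- con 1ℚ) := con ½ :* (con 1ℚ :- x)) refl
          (κ i (n ∸ i) n)))
      where
      i≤n : (1 ℕ.≤ i × i ℕ.< m) ⊎ (m ℕ.< i × i ℕ.≤ n) → i ℕ.≤ n
      i≤n (inj₁ (_ , i<m)) = ℕ.≤-trans (ℕ.s≤s⁻¹ i<m) (ℕ.≤-trans r≤n′ (ℕ.n≤1+n n′))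
      i≤n (inj₂ (_ , i≤n)) = i≤n
      i+[n∸i]≡n : i ℕ.+ (n ∸ i) ≡ n
      i+[n∸i]≡n = ℕ.m+[n∸m]≡n (i≤n i-range)
    β≤x* : β ≤ LP.objective m n a 0<a x*
    -- At k = n the coefficient is 1 - (2b - 1) = 2 - 2b, so the value is exactly b - 1.
    β≤x* = ≤-eventually {z = 0ℝ} (0≤-eventually (always λ _ → ℚ.≤-refl)) (map₁ (λ N b+b≡t → trans
      (cong (λ s → (ℚ.- s) ℚ.- (b N ℚ.- 1ℚ)) (trans (seq-sum-lastHalf n′ c N)
        (cong (ℚ._* ½) (trans (seq-c n N) (cong₂ (λ x y → x ℚ.+ (t N ℚ.- 1ℚ) ℚ.* y) (κ₀-top n) κ-top)))))
      (trans (cong (λ t → (ℚ.- ((1ℚ ℚ.+ (t ℚ.- 1ℚ) ℚ.* (ℚ.- 1ℚ)) ℚ.* ½)) ℚ.- (b N ℚ.- 1ℚ)) (sym b+b≡t))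
        (solve 1 (λ b → (:- ((con 1ℚ :+ (b :+ b :- con 1ℚ) :* (:- con 1ℚ)) :* con ½)) :- (b :- con 1ℚ) := con 0ℚ)
          refl (b N)))) b+b≡t)

-- Splitting by parity.

even∨odd : ∀ m → ∃[ h ] (m ≡ h ℕ.* 2 ⊎ m ≡ suc (h ℕ.* 2))
even∨odd zero = 0 , inj₁ refl
even∨odd (suc m) with even∨odd m
... | h , inj₁ refl = h , inj₂ refl
... | h , inj₂ refl = suc h , inj₁ refl

theorem4 : (a : ℝ) (0<a : 0ℝ < a) → a ≤ fromℚ ½ → (m : ℕ) → 2 ℕ.≤ m →
    (2 ∣ m → (λ n → LP.IsOptimalValue m n a 0<a) TendsTo 0ℝ) ×
    (2 ∤ m → (λ n → LP.IsOptimalValue m n a 0<a) TendsTo (1/ (2ℝ * a) [ 2*-pos {a} 0<a ] - 1ℝ))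
theorem4 a 0<a a≤½ m 2≤m = even , odd (even∨odd m)
  where
  even : 2 ∣ m → (λ n → LP.IsOptimalValue m n a 0<a) TendsTo 0ℝ
  even (divides h refl) = even-limit a 0<a a≤½ h
  odd : ∃[ h ] (m ≡ h ℕ.* 2 ⊎ m ≡ suc (h ℕ.* 2)) → 2 ∤ m →
    (λ n → LP.IsOptimalValue m n a 0<a) TendsTo (1/ (2ℝ * a) [ 2*-pos {a} 0<a ] - 1ℝ)
  odd (h , inj₁ m≡h*2) 2∤m = ⊥-elim (2∤m (divides h m≡h*2))
  -- From m ≥ 2 follows r = m - 1 ≥ 1, so the constraint carrying the multiplier belongs to the
  -- program.
  odd (h , inj₂ refl)  2∤m = odd-limit a 0<a a≤½ h (ℕ.s≤s⁻¹ 2≤m)
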